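{- Let $G$ be a graph of order $n$. Then $\phi'(G)\le 10^{n/5}$. Furthermore, $\phi'(G)=10^{n/5}$ if and only if $n\equiv 0\pmod 5$ and $G$ is the disjoint union of $n/5$ graphs each of which is isomorphic to a graph obtained from the complete graph $K_5$ by deleting $i$ pairwise non-adjacent edges (i.e. edges forming a matching), for some $0\le i\le 2$ (the value of $i$ may differ between the copies).
   Context: All graphs are finite, simple, undirected and labeled. A subset of vertices $F$ of a graph $G$ is a dissociation set if the induced subgraph $G[F]$ has maximum degree at most $1$. A maximum dissociation set is a dissociation set of maximum size. $\phi'(G)$ denotes the number of maximum dissociation sets of $G$. -}

module Defs where

open import Data.Bool using (Bool; true; false; _∧_; _∨_; not)
open import Data.Nat using (ℕ; zero; suc; _≤_; _<_; _<?_; _≤?_)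
open import Data.Fin using (Fin; _≟_)
open import Data.Fin.Subset using (Subset; _∈_; ∣_∣; inside; outside)
open import Data.Fin.Subset.Properties using (_∈?_; anySubset?)
open import Data.Fin.Properties using (all?)
open import Data.Vec using (Vec; []; _∷_)
open import Data.List using (List; []; _∷_; map; _++_; length; filter)
open import Data.Bool.ListAction using (any)
open import Data.List.Relation.Unary.All using (All)
open import Data.List.Relation.Unary.AllPairs using (AllPairs)
open import Data.Product using (Σ; _×_; _,_; ∃; ∃-syntax)
open import Data.Product.Relation.Unary.All using () 
open import Relation.Nullary using (Dec; yes; no; ¬_; does)
open import Relation.Nullary.Decidable using (_×-dec_; _→-dec_; ¬?)
open import Relation.Binary.PropositionalEquality using (_≡_; _≢_)
open import Function.Bundles using (_↔_; Inverse)

record Graph (n : ℕ) : Set where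
  field
    adj    : Fin n → Fin n → Bool
    sym    : ∀ u v → adj u v ≡ adj v u
    irrefl : ∀ v → adj v v ≡ false

open Graph public

Adj : ∀ {n} → Graph n → Fin n → Fin n → Set
Adj G u v = adj G u v ≡ true

-- F is a dissociation set: G[F] has maximum degree at most 1,
-- i.e. every vertex of F has at most one neighbour in F.
IsDissociation : ∀ {n} → Graph n → Subset n → Set
IsDissociation G F =
  ∀ u v w → u ∈ F → v ∈ F → w ∈ F → Adj G u v → Adj G u w → v ≡ w

IsMaxDissociation : ∀ {n} → Graph n → Subset n → Set
IsMaxDissociation G F =
  IsDissociation G F × (∀ F' → IsDissociation G F' → ∣ F' ∣ ≤ ∣ F ∣)

private
  adj? : ∀ {n} (G : Graph n) u v → Dec (Adj G u v)
  adj? G u v with adj G u v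
  ... | true  = yes _≡_.refl
  ... | false = no λ ()

isDissociation? : ∀ {n} (G : Graph n) F → Dec (IsDissociation G F)
isDissociation? G F =
  all? λ u → all? λ v → all? λ w →
    (u ∈? F) →-dec ((v ∈? F) →-dec ((w ∈? F) →-dec
      (adj? G u v →-dec (adj? G u w →-dec (v ≟ w)))))

isMaxDissociation? : ∀ {n} (G : Graph n) F → Dec (IsMaxDissociation G F)
isMaxDissociation? G F with isDissociation? G F
... | no ¬d = no λ (d , _) → ¬d d
... | yes d with anySubset? (λ F' → isDissociation? G F' ×-dec (∣ F ∣ <? ∣ F' ∣))
...   | yes (F' , d' , lt) = no λ (_ , mx) → Data.Nat.Properties.<⇒≱ lt (mx F' d')
  where import Data.Nat.Properties
...   | no ¬big = yes (d , λ F' d' → helper F' d')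
  where
    import Data.Nat.Properties as NP
    helper : ∀ F' → IsDissociation G F' → ∣ F' ∣ ≤ ∣ F ∣
    helper F' d' with ∣ F' ∣ ≤? ∣ F ∣
    ... | yes le = le
    ... | no nle = Data.Empty.⊥-elim (¬big (F' , d' , NP.≰⇒> nle))
      where import Data.Empty

allSubsets : ∀ n → List (Subset n)
allSubsets zero    = [] ∷ []
allSubsets (suc n) = map (inside ∷_) (allSubsets n) ++ map (outside ∷_) (allSubsets n)

φ′ : ∀ {n} → Graph n → ℕ
φ′ {n} G = length (filter (isMaxDissociation? G) (allSubsets n))

Disjoint : (Fin 5 × Fin 5) → (Fin 5 × Fin 5) → Set
Disjoint (a , b) (c , d) = a ≢ c × a ≢ d × b ≢ c × b ≢ d

record Matching5 : Set where
  field
    edges   : List (Fin 5 × Fin 5)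
    proper  : All (λ (e : Fin 5 × Fin 5) → Data.Product.proj₁ e ≢ Data.Product.proj₂ e) edges
    disjoint : AllPairs Disjoint edges
open Matching5 public

edgeIn : List (Fin 5 × Fin 5) → Fin 5 → Fin 5 → Bool
edgeIn M u v = any (λ (e : Fin 5 × Fin 5) → let (a , b) = e in
  (does (u ≟ a) ∧ does (v ≟ b)) ∨ (does (u ≟ b) ∧ does (v ≟ a))) M

K5minus : List (Fin 5 × Fin 5) → Fin 5 → Fin 5 → Bool
K5minus M u v = not (does (u ≟ v)) ∧ not (edgeIn M u v)

unionAdj : ∀ {k} → (Fin k → Matching5) → (Fin k × Fin 5) → (Fin k × Fin 5) → Bool
unionAdj M (j , a) (j' , b) = does (j Data.Fin.≟ j') ∧ K5minus (edges (M j)) a b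

IsExtremal : ∀ {n} → Graph n → Set
IsExtremal {n} G =
  Σ ℕ λ k → (n ≡ 5 Data.Nat.* k) ×
  Σ (Fin k → Matching5) λ M →
    (∀ j → length (edges (M j)) ≤ 2) ×
    Σ (Fin n ↔ (Fin k × Fin 5)) λ σ →
      ∀ u v → adj G u v ≡ unionAdj M (Inverse.to σ u) (Inverse.to σ v)

{-# OPTIONS --safe #-}
-- A maximum dissociation set F of G[S] is decomposed along one component C of G[F] (a vertex or an edge):
-- F - C is a maximum dissociation set of G[S - N[C]]. Counting over all C that can occur at a well-chosen vertex
-- gives recurrences whose weights 10^(-k/5), k = |N[C]|, sum to less than 1, with one exception: a vertex v
-- of degree 4 whose neighbourhood closes up to a component K = N[v]. If two vertices of K are missed by a third, then
-- maximality excludes v from every F; otherwise the complement of K is a matching, every F meets K in one of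
-- its ten pairs, and equality reduces to G[S - K].
-- At vertices of degree 2 and 3 the plain recurrence is too weak. One then uses that G - v has a leaf, or that
-- maximality forces a further vertex into F when v is isolated in G[F].
module Submission where

open import Defs
open import Data.Nat using (ℕ; _≤_; _^_)
open import Data.Product using (_×_)
open import Function.Bundles using (_⇔_)
open import Relation.Binary.PropositionalEquality using (_≡_)

open import Data.Bool using (Bool; true; false; T; not; _∧_; _∨_)
import Data.Bool.Properties as Bool
open import Data.Empty using (⊥; ⊥-elim)
open import Data.Fin using (Fin; zero; suc; _≟_; cast; toℕ)
import Data.Fin.Properties as Fin
open import Data.Fin.Subset using (Subset; _∈_; _∉_; _⊆_; ∣_∣; _-_; inside; outside; ⊤) renaming (⊥ to ∅)
open import Data.Fin.Subset.Properties using
  (_∈?_; ∈⊤; ∉⊥; ∣⊤∣≡n; ∣⊥∣≡0; p⊆q⇒∣p∣≤∣q∣; x∈p∧x≢y⇒x∈p-y; x∈p⇒∣p-x∣<∣p∣; p─⊥≡p; p─q⊆p; ⊆-antisym)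
open import Data.List using
  (List; []; _∷_; _++_; length; map; filter; allFin; lookup; concatMap; cartesianProduct; cartesianProductWith)
open import Data.List.Properties using (length-++; length-map; length-tabulate)
import Data.List.Membership.DecPropositional
open import Data.List.Membership.Propositional using (find; lose) renaming (_∈_ to _∈ₗ_; _∉_ to _∉ₗ_)
open import Data.List.Membership.Propositional.Properties using
  (∈-allFin; ∈-filter⁺; ∈-filter⁻; ∈-map⁺; ∈-map⁻; ∈-++⁺ˡ; ∈-++⁺ʳ; ∈-++⁻; ∈-lookup; ∈-concatMap⁺)
open import Data.List.Relation.Binary.Permutation.Propositional using (_↭_; ↭⇒↭ₛ; ↭-refl; ↭-sym; ↭-trans; prep; swap)
open import Data.List.Relation.Binary.Permutation.Propositional.Properties using (∈-resp-↭; ↭-length)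
import Data.List.Relation.Binary.Permutation.Setoid.Properties as PermutationSetoid
open import Data.List.Relation.Unary.All as All using (All; []; _∷_)
import Data.List.Relation.Unary.All.Properties as All
open import Data.List.Relation.Unary.AllPairs as AllPairs using (AllPairs; []; _∷_)
open import Data.List.Relation.Unary.Any as Any using (Any; here; there)
open import Data.List.Relation.Unary.Any.Properties using (lookup-index)
open import Data.List.Relation.Unary.Unique.Propositional using (Unique)
import Data.List.Relation.Unary.Unique.Propositional.Properties as Unique
open import Data.Nat using
  (zero; suc; _+_; _*_; _∸_; _<_; _≤ᵇ_; _≤?_; z≤n; s≤s; s≤s⁻¹; NonZero; ≢-nonZero⁻¹)
open import Data.Nat.Properties hiding (_≟_)
open import Data.Product using (Σ; _,_; ∃; proj₁; proj₂)
open import Data.Sum as Sum using (_⊎_; inj₁; inj₂; [_,_]′)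
open import Data.Unit using (tt)
open import Data.Vec as Vec using (Vec; []; _∷_; tabulate)
open import Data.Vec.Properties using
  (lookup∘tabulate; tabulate∘lookup; tabulate-cong; lookup⇒[]=; []=⇒lookup; ∷-injective)
open import Function using (_∘_; id)
open import Function.Bundles using (_↔_; Inverse; mk↔ₛ′; mk⇔)
open import Relation.Binary.PropositionalEquality as ≡ using (_≢_; refl; cong; cong₂; subst; subst₂)
open import Relation.Nullary using (Dec; yes; no; ¬_; does; contradiction)
open import Relation.Nullary.Decidable using (_×-dec_; _⊎-dec_; _→-dec_; ¬?; dec-true; dec-false; from-yes)

-- Fifth roots never appear: bounds are carried as inequalities between fifth powers, and each
-- weight 10^(-k/5) is rounded up to a multiple of one millionth, so that every recurrence closes by
-- comparing integers. The upper bound and the equality case are one induction over vertex subsets S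
-- of a fixed graph: a recurrence with sum at most 0.999999 makes the bound for S strict, and
-- strictness survives adding back a five-vertex component. The obstacle is that the plain
-- recurrence at a vertex v of degree d, 10^(-1/5) for the sets without v plus d + 1 terms
-- 10^(-(d+1)/5) for v isolated or paired, exceeds 1 for every d from 1 to 5. What rescues it is a
-- gain at each neighbour u of v, of one of two kinds. If u has no neighbour outside N[v], then v is
-- never isolated in F, because u could be added. If u has one, then N[{v,u}] is larger than N[v]
-- and the term of the pair shrinks.

-- Adding and comparing fifth roots in integers

^-distribʳ-* : ∀ k a b → (a * b) ^ k ≡ a ^ k * b ^ k
^-distribʳ-* zero    a b = refl
^-distribʳ-* (suc k) a b =
  ≡.trans (cong ((a * b) *_) (^-distribʳ-* k a b)) ([m*n]*[o*p]≡[m*o]*[n*p] a b (a ^ k) (b ^ k))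

n^5≡0⇒n≡0 : ∀ a K .{{_ : NonZero K}} → a ^ 5 * K ≤ 0 → a ≡ 0
n^5≡0⇒n≡0 a K h with m*n≡0⇒m≡0∨n≡0 (a ^ 5) (n≤0⇒n≡0 h)
... | inj₁ e = m^n≡0⇒m≡0 a 5 e
... | inj₂ e = ⊥-elim (≢-nonZero⁻¹ K e)

-- If a / p ≤ b / q, the mediant (a + b) / (p + q) is at most b / q.
mediant-bound : ∀ K T a b p q .{{_ : NonZero q}} → a * q ≤ b * p →
  b ^ 5 * K ≤ q ^ 5 * T → (a + b) ^ 5 * K ≤ (p + q) ^ 5 * T
mediant-bound K T a b p q le hb = *-cancelˡ-≤ (q ^ 5) {{m^n≢0 q 5}} (begin
  q ^ 5 * ((a + b) ^ 5 * K)   ≡⟨ *-assoc (q ^ 5) _ K ⟨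
  q ^ 5 * (a + b) ^ 5 * K     ≡⟨ cong (_* K) (^-distribʳ-* 5 q (a + b)) ⟨
  (q * (a + b)) ^ 5 * K       ≤⟨ *-monoˡ-≤ K (^-monoˡ-≤ 5 step) ⟩
  (b * (p + q)) ^ 5 * K       ≡⟨ cong (_* K) (^-distribʳ-* 5 b (p + q)) ⟩
  b ^ 5 * (p + q) ^ 5 * K     ≡⟨ cong (_* K) (*-comm (b ^ 5) ((p + q) ^ 5)) ⟩
  (p + q) ^ 5 * b ^ 5 * K     ≡⟨ *-assoc ((p + q) ^ 5) _ K ⟩
  (p + q) ^ 5 * (b ^ 5 * K)   ≤⟨ *-monoʳ-≤ ((p + q) ^ 5) hb ⟩
  (p + q) ^ 5 * (q ^ 5 * T)   ≡⟨ *-assoc ((p + q) ^ 5) _ T ⟨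
  (p + q) ^ 5 * q ^ 5 * T     ≡⟨ cong (_* T) (*-comm ((p + q) ^ 5) (q ^ 5)) ⟩
  q ^ 5 * (p + q) ^ 5 * T     ≡⟨ *-assoc (q ^ 5) _ T ⟩
  q ^ 5 * ((p + q) ^ 5 * T)   ∎)
  where
  open ≤-Reasoning
  step : q * (a + b) ≤ b * (p + q)
  step = begin
    q * (a + b)    ≡⟨ *-distribˡ-+ q a b ⟩
    q * a + q * b  ≡⟨ cong₂ _+_ (*-comm q a) (*-comm q b) ⟩
    a * q + b * q  ≤⟨ +-monoˡ-≤ (b * q) le ⟩
    b * p + b * q  ≡⟨ *-distribˡ-+ b p q ⟨
    b * (p + q)    ∎

mediant-bound′ : ∀ K T a b p q .{{_ : NonZero K}} → a * q ≤ b * p →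
  a ^ 5 * K ≤ p ^ 5 * T → b ^ 5 * K ≤ q ^ 5 * T → (a + b) ^ 5 * K ≤ (p + q) ^ 5 * T
-- With `q` = 0 there is no ratio b / q; but then `b` = 0, and the claim is the hypothesis on `a`.
mediant-bound′ K T a b p zero le ha hb with n^5≡0⇒n≡0 b K hb
... | refl = subst₂ _≤_ (cong (λ z → z ^ 5 * K) (≡.sym (+-identityʳ a)))
                        (cong (λ z → z ^ 5 * T) (≡.sym (+-identityʳ p))) ha
mediant-bound′ K T a b p q@(suc _) le _ hb = mediant-bound K T a b p q le hb

-- With c = (T / K)^(1/5) the hypotheses read a ≤ p c and b ≤ q c, and these add up. In integers,
-- the larger of the ratios a / p and b / q dominates the mediant.
fifth-power-+ : ∀ K T a b p q .{{_ : NonZero K}} →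
  a ^ 5 * K ≤ p ^ 5 * T → b ^ 5 * K ≤ q ^ 5 * T → (a + b) ^ 5 * K ≤ (p + q) ^ 5 * T
fifth-power-+ K T a b p q ha hb with ≤-total (a * q) (b * p)
... | inj₁ le = mediant-bound′ K T a b p q le ha hb
... | inj₂ ge = subst₂ _≤_ (cong (λ z → z ^ 5 * K) (+-comm b a)) (cong (λ z → z ^ 5 * T) (+-comm q p))
  (mediant-bound′ K T b a q p ge hb ha)

fifth-power-growth : ∀ p q r {x y z} .{{_ : NonZero p}} →
  p * y ≤ q * x → q ^ 5 ≤ p ^ 5 * r → x ^ 5 ≤ z → y ^ 5 ≤ r * z
fifth-power-growth p q r {x} {y} {z} le c h = *-cancelˡ-≤ (p ^ 5) {{m^n≢0 p 5}} (begin
  p ^ 5 * y ^ 5    ≡⟨ ^-distribʳ-* 5 p y ⟨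
  (p * y) ^ 5      ≤⟨ ^-monoˡ-≤ 5 le ⟩
  (q * x) ^ 5      ≡⟨ ^-distribʳ-* 5 q x ⟩
  q ^ 5 * x ^ 5    ≤⟨ *-mono-≤ c h ⟩
  p ^ 5 * r * z    ≡⟨ *-assoc (p ^ 5) r z ⟩
  p ^ 5 * (r * z)  ∎)
  where open ≤-Reasoning

-- One more unit multiplies the base by at most 6 / 5. Any bound on this ratio whose fifth power is
-- at most 10 serves; 3 / 2 is one.
fifth-power≤exponential : ∀ c e → 5 ^ 5 ≤ c → (5 + e) ^ 5 ≤ 10 ^ e * c
fifth-power≤exponential c zero    h = subst (5 ^ 5 ≤_) (≡.sym (*-identityˡ c)) h
fifth-power≤exponential c (suc e) h =
  subst ((5 + suc e) ^ 5 ≤_) (≡.sym (*-assoc 10 (10 ^ e) c))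
    (fifth-power-growth 2 3 10 {5 + e} {5 + suc e} ratio (≤ᵇ⇒≤ _ _ tt) (fifth-power≤exponential c e h))
  where
  open ≤-Reasoning
  ratio : 2 * (5 + suc e) ≤ 3 * (5 + e)
  ratio = begin
    2 * (5 + suc e)   ≡⟨ *-distribˡ-+ 2 5 (suc e) ⟩
    10 + 2 * suc e    ≡⟨ cong (10 +_) (*-distribˡ-+ 2 1 e) ⟩
    12 + 2 * e        ≤⟨ +-mono-≤ (≤ᵇ⇒≤ 12 15 tt) (*-monoˡ-≤ e (≤ᵇ⇒≤ 2 3 tt)) ⟩
    15 + 3 * e        ≡⟨ *-distribˡ-+ 3 5 e ⟨
    3 * (5 + e)       ∎

-- Bounds on the number of elements with a property

-- At most p · (T / K)^(1/5) elements satisfy P.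
record Bounded {A : Set} (K T p : ℕ) (P : A → Set) : Set where
  constructor bounded
  field length-bound : ∀ l → Unique l → All P l → length l ^ 5 * K ≤ p ^ 5 * T
open Bounded public

module _ {A : Set} {P Q : A → Set} where

  -- Inheritance is stated for arbitrary `R`; at `R` = (x ≢_) it keeps both halves free of
  -- duplicates.
  record Split (l : List A) : Set₁ where
    field
      left right  : List A
      left⊆       : ∀ {R : A → Set} → All R l → All R left
      right⊆      : ∀ {R : A → Set} → All R l → All R right
      left-uniq   : Unique left
      right-uniq  : Unique right
      left-P      : All P left
      right-Q     : All Q right
      lengths     : length l ≡ length left + length right

  split : ∀ l → Unique l → All (λ x → P x ⊎ Q x) l → Split l
  split [] _ _ = record
    { left = [] ; right = [] ; left⊆ = λ _ → [] ; right⊆ = λ _ → [] ; left-uniq = [] ; right-uniq = []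
    ; left-P = [] ; right-Q = [] ; lengths = refl }
  split (x ∷ l) (x∉ ∷ u) (inj₁ px ∷ h) = record
    { left = x ∷ left ; right = right ; left⊆ = λ { (r ∷ rs) → r ∷ left⊆ rs } ; right⊆ = λ { (_ ∷ rs) → right⊆ rs }
    ; left-uniq = left⊆ x∉ ∷ left-uniq ; right-uniq = right-uniq
    ; left-P = px ∷ left-P ; right-Q = right-Q ; lengths = cong suc lengths }
    where open Split (split l u h)
  split (x ∷ l) (x∉ ∷ u) (inj₂ qx ∷ h) = record
    { left = left ; right = x ∷ right ; left⊆ = λ { (_ ∷ rs) → left⊆ rs } ; right⊆ = λ { (r ∷ rs) → r ∷ right⊆ rs }
    ; left-uniq = left-uniq ; right-uniq = right⊆ x∉ ∷ right-uniq
    ; left-P = left-P ; right-Q = qx ∷ right-Q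
    ; lengths = ≡.trans (cong suc lengths) (≡.sym (+-suc (length left) (length right))) }
    where open Split (split l u h)

  Bounded-⊎ : ∀ {K T p q} .{{_ : NonZero K}} →
    Bounded K T p P → Bounded K T q Q → Bounded K T (p + q) (λ x → P x ⊎ Q x)
  Bounded-⊎ {K} {T} {p} {q} bp bq = bounded λ l u h → let open Split (split l u h) in
    subst (λ z → z ^ 5 * K ≤ (p + q) ^ 5 * T) (≡.sym lengths)
      (fifth-power-+ K T (length left) (length right) p q
        (length-bound bp left left-uniq left-P) (length-bound bq right right-uniq right-Q))

  Bounded-⊆ : ∀ {K T p} → (∀ {x} → P x → Q x) → Bounded K T p Q → Bounded K T p P
  Bounded-⊆ P⊆Q b = bounded λ l u h → length-bound b l u (All.map P⊆Q h)

Bounded-⊥ : ∀ {A : Set} {K T} {P : A → Set} → (∀ {x} → P x → ⊥) → Bounded K T 0 P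
Bounded-⊥ none = bounded λ { [] _ _ → z≤n ; (x ∷ l) _ (px ∷ _) → ⊥-elim (none px) }

Bounded-Any : ∀ {A I : Set} {K T} .{{_ : NonZero K}} {P : I → A → Set} (is : List I) →
  (∀ i → i ∈ₗ is → Bounded K T 1 (P i)) → Bounded K T (length is) (λ x → Any (λ i → P i x) is)
Bounded-Any []       b = Bounded-⊥ λ ()
Bounded-Any (i ∷ is) b =
  Bounded-⊆ (λ { (here p) → inj₁ p ; (there p) → inj₂ p })
    (Bounded-⊎ (b i (here refl)) (Bounded-Any is (λ j j∈ → b j (there j∈))))

Bounded-injective : ∀ {A B : Set} {K T p} {P : A → Set} {Q : B → Set} (f : A → B) →
  (∀ {x} → P x → Q (f x)) → (∀ {x y} → P x → P y → f x ≡ f y → x ≡ y) →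
  Bounded K T p Q → Bounded K T p P
Bounded-injective {K = K} {T} {p} {P} {Q} f into inj b = bounded λ l u h →
  subst (λ z → z ^ 5 * K ≤ p ^ 5 * T) (length-map f l)
    (length-bound b (map f l) (uniq l u h) (All.map⁺ (All.map into h)))
  where
  uniq : ∀ l → Unique l → All P l → Unique (map f l)
  uniq []      _        _         = []
  uniq (x ∷ l) (x∉ ∷ u) (px ∷ pl) =
    All.map⁺ (All.zipWith (λ { (x≢y , py) e → x≢y (inj px py e) }) (x∉ , pl)) ∷ uniq l u pl

-- The hypothesis is p (T / K)^(1/5) ≤ p' (T' / K')^(1/5) with fifth powers taken and denominators
-- cleared.
Bounded-rescale : ∀ {A : Set} {K T p K' T' p'} {P : A → Set} .{{_ : NonZero K}} →
  p ^ 5 * T * K' ≤ p' ^ 5 * T' * K → Bounded K T p P → Bounded K' T' p' P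
Bounded-rescale {K = K} {T} {p} {K'} {T'} {p'} le b = bounded λ l u h → *-cancelʳ-≤ _ _ K (begin
  length l ^ 5 * K' * K   ≡⟨ *-assoc (length l ^ 5) K' K ⟩
  length l ^ 5 * (K' * K) ≡⟨ cong (length l ^ 5 *_) (*-comm K' K) ⟩
  length l ^ 5 * (K * K') ≡⟨ *-assoc (length l ^ 5) K K' ⟨
  length l ^ 5 * K * K'   ≤⟨ *-monoˡ-≤ K' (length-bound b l u h) ⟩
  p ^ 5 * T * K'          ≤⟨ le ⟩
  p' ^ 5 * T' * K         ∎)
  where open ≤-Reasoning

module _ {A : Set} {P : A → Set} where

  Bounded-shift : ∀ {K m m' p p'} k .{{_ : NonZero K}} → p ^ 5 ≤ p' ^ 5 * 10 ^ k → k + m' ≤ m →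
    Bounded K (10 ^ m') p P → Bounded K (10 ^ m) p' P
  Bounded-shift {K} {m} {m'} {p} {p'} k c le = Bounded-rescale (*-monoˡ-≤ K (begin
    p ^ 5 * 10 ^ m'              ≤⟨ *-monoˡ-≤ (10 ^ m') c ⟩
    p' ^ 5 * 10 ^ k * 10 ^ m'    ≡⟨ *-assoc (p' ^ 5) _ _ ⟩
    p' ^ 5 * (10 ^ k * 10 ^ m')  ≡⟨ cong (p' ^ 5 *_) (^-distribˡ-+-* 10 k m') ⟨
    p' ^ 5 * 10 ^ (k + m')       ≤⟨ *-monoʳ-≤ (p' ^ 5) (^-monoʳ-≤ 10 le) ⟩
    p' ^ 5 * 10 ^ m              ∎))
    where open ≤-Reasoning

  -- This amounts to d^5 K ≤ p^5 10^(d+b-5). At d = 5 it follows from the hypotheses on `c`; raising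
  -- d by one multiplies the right side by 10 and d^5 by less.
  Bounded-many : ∀ {K T c} d b p → 5 ≤ d → 5 ^ 5 ≤ c → c * K ≤ p ^ 5 * 10 ^ b →
    Bounded (10 ^ (d + (b ∸ 5))) T d P → 5 ≤ b → Bounded K T p P
  Bounded-many {K} {T} {c} d b p 5≤d h c≤ bd 5≤b = Bounded-rescale {{m^n≢0 10 (d + (b ∸ 5))}} (begin
    d ^ 5 * T * K                       ≡⟨ *-assoc (d ^ 5) _ _ ⟩
    d ^ 5 * (T * K)                     ≡⟨ cong (d ^ 5 *_) (*-comm T _) ⟩
    d ^ 5 * (K * T)                     ≡⟨ *-assoc (d ^ 5) _ _ ⟨
    d ^ 5 * K * T                       ≤⟨ *-monoˡ-≤ T coefficient ⟩
    p ^ 5 * 10 ^ (d + (b ∸ 5)) * T      ≡⟨ *-assoc (p ^ 5) _ _ ⟩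
    p ^ 5 * (10 ^ (d + (b ∸ 5)) * T)    ≡⟨ cong (p ^ 5 *_) (*-comm (10 ^ (d + (b ∸ 5))) _) ⟩
    p ^ 5 * (T * 10 ^ (d + (b ∸ 5)))    ≡⟨ *-assoc (p ^ 5) _ _ ⟨
    p ^ 5 * T * 10 ^ (d + (b ∸ 5))      ∎) bd
    where
    open ≤-Reasoning
    e = d ∸ 5
    d≡ : 5 + e ≡ d
    d≡ = m+[n∸m]≡n 5≤d
    b+e≡ : b + e ≡ d + (b ∸ 5)
    b+e≡ = begin-equality
      b + e              ≡⟨ cong (_+ e) (m∸n+n≡m 5≤b) ⟨
      b ∸ 5 + 5 + e      ≡⟨ +-assoc (b ∸ 5) 5 e ⟩
      b ∸ 5 + (5 + e)    ≡⟨ cong (b ∸ 5 +_) d≡ ⟩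
      b ∸ 5 + d          ≡⟨ +-comm (b ∸ 5) d ⟩
      d + (b ∸ 5)        ∎
    coefficient : d ^ 5 * K ≤ p ^ 5 * 10 ^ (d + (b ∸ 5))
    coefficient = begin
      d ^ 5 * K                        ≡⟨ cong (λ z → z ^ 5 * K) d≡ ⟨
      (5 + e) ^ 5 * K                  ≤⟨ *-monoˡ-≤ K (fifth-power≤exponential c e h) ⟩
      10 ^ e * c * K                   ≡⟨ *-assoc (10 ^ e) c K ⟩
      10 ^ e * (c * K)                 ≤⟨ *-monoʳ-≤ (10 ^ e) c≤ ⟩
      10 ^ e * (p ^ 5 * 10 ^ b)        ≡⟨ *-comm (10 ^ e) _ ⟩
      p ^ 5 * 10 ^ b * 10 ^ e          ≡⟨ *-assoc (p ^ 5) _ _ ⟩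
      p ^ 5 * (10 ^ b * 10 ^ e)        ≡⟨ cong (p ^ 5 *_) (^-distribˡ-+-* 10 b e) ⟨
      p ^ 5 * 10 ^ (b + e)             ≡⟨ cong (λ z → p ^ 5 * 10 ^ z) b+e≡ ⟩
      p ^ 5 * 10 ^ (d + (b ∸ 5))       ∎

-- Bounds p are measured in units of 10⁻⁶ · 10^(m/5), so that 10^((m-k)/5) is about 630958, 398108, 251189, 158490,
-- 100000, 63096, 39811 for k = 1, …, 7, and 999999 is a strict bound.
unit : ℕ
unit = 1000000

scale : ℕ
scale = unit ^ 5

Few : {A : Set} → ℕ → ℕ → (A → Set) → Set
Few m p P = Bounded scale (10 ^ m) p P

module _ {A : Set} {P : A → Set} where

  Few-shift : ∀ {m m' p'} k p → T (p' ^ 5 ≤ᵇ p ^ 5 * 10 ^ k) → k + m' ≤ m → Few m' p' P → Few m p P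
  Few-shift k p c = Bounded-shift k (≤ᵇ⇒≤ _ _ c)

  Few-weight : ∀ {m} k d p → T (d ^ 5 * scale ≤ᵇ p ^ 5 * 10 ^ k) → Bounded (10 ^ k) (10 ^ m) d P → Few m p P
  Few-weight {m} k d p c = Bounded-rescale {{m^n≢0 10 k}} (weight-rescale (10 ^ m) (10 ^ k) (d ^ 5) (p ^ 5) (≤ᵇ⇒≤ _ _ c))
    where
    weight-rescale : ∀ T K {K'} a b → a * K' ≤ b * K → a * T * K' ≤ b * T * K
    weight-rescale T K {K'} a b le = begin
      a * T * K'    ≡⟨ *-assoc a T K' ⟩
      a * (T * K')  ≡⟨ cong (a *_) (*-comm T K') ⟩
      a * (K' * T)  ≡⟨ *-assoc a K' T ⟨
      a * K' * T    ≤⟨ *-monoˡ-≤ T le ⟩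
      b * K * T     ≡⟨ *-assoc b K T ⟩
      b * (K * T)   ≡⟨ cong (b *_) (*-comm K T) ⟩
      b * (T * K)   ≡⟨ *-assoc b T K ⟨
      b * T * K     ∎
      where open ≤-Reasoning

  Few-mono : ∀ {m p q} → p ≤ q → Few m p P → Few m q P
  Few-mono {m} {p} {q} le b = bounded λ l u h →
    ≤-trans (length-bound b l u h) (*-monoˡ-≤ (10 ^ m) (^-monoˡ-≤ 5 le))

  -- The sum d · 10^(-(d+a)/5) is largest at d = 5 among d ≥ 5.
  Few-many : ∀ {m} d a p → 5 ≤ d → T (5 ^ 5 * scale ≤ᵇ p ^ 5 * 10 ^ (5 + a)) →
    Bounded (10 ^ (d + a)) (10 ^ m) d P → Few m p P
  Few-many d a p 5≤d c b = Bounded-many {c = 5 ^ 5} d (5 + a) p 5≤d ≤-refl (≤ᵇ⇒≤ _ _ c) b (m≤m+n 5 a)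

-- Cardinalities of subsets and lists

module _ {n : ℕ} where
  open Data.List.Membership.DecPropositional (_≟_ {n}) public using () renaming (_∈?_ to _∈ₗ?_)

module _ {n : ℕ} {P : Fin n → Set} (P? : ∀ x → Dec (P x)) where

  select : Subset n
  select = tabulate (does ∘ P?)

  ∈-select⁺ : ∀ {x} → P x → x ∈ select
  ∈-select⁺ {x} px = lookup⇒[]= x select (≡.trans (lookup∘tabulate (does ∘ P?) x) (dec-true (P? x) px))

  ∈-select⁻ : ∀ {x} → x ∈ select → P x
  ∈-select⁻ {x} x∈ with P? x | ≡.trans (≡.sym (lookup∘tabulate (does ∘ P?) x)) ([]=⇒lookup x∈)
  ... | yes px | _ = px

module _ {n : ℕ} where

  infixl 6 _∖_ _⊕_

  opaque
    private
      ∖? : ∀ (A : Subset n) (C : List (Fin n)) x → Dec (x ∈ A × x ∉ₗ C)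
      ∖? A C x = (x ∈? A) ×-dec ¬? (x ∈ₗ? C)

      ⊕? : ∀ (A : Subset n) (C : List (Fin n)) x → Dec (x ∈ A ⊎ x ∈ₗ C)
      ⊕? A C x = (x ∈? A) ⊎-dec (x ∈ₗ? C)

    _∖_ : Subset n → List (Fin n) → Subset n
    A ∖ C = select (∖? A C)

    _⊕_ : Subset n → List (Fin n) → Subset n
    A ⊕ C = select (⊕? A C)

    ∈-∖⁺ : ∀ {A : Subset n} {C x} → x ∈ A → x ∉ₗ C → x ∈ A ∖ C
    ∈-∖⁺ {A} {C} x∈A x∉C = ∈-select⁺ (∖? A C) (x∈A , x∉C)

    ∈-∖⁻ : ∀ (A : Subset n) C {x} → x ∈ A ∖ C → x ∈ A × x ∉ₗ C
    ∈-∖⁻ A C = ∈-select⁻ (∖? A C)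

    ∈-⊕⁺ : ∀ {A : Subset n} {C x} → x ∈ A ⊎ x ∈ₗ C → x ∈ A ⊕ C
    ∈-⊕⁺ {A} {C} = ∈-select⁺ (⊕? A C)

    ∈-⊕⁻ : ∀ (A : Subset n) C {x} → x ∈ A ⊕ C → x ∈ A ⊎ x ∈ₗ C
    ∈-⊕⁻ A C = ∈-select⁻ (⊕? A C)

  ∣∣-drop : ∀ {A B : Subset n} L → A ⊆ B → Unique L → All (_∈ B) L → All (_∉ A) L → length L + ∣ A ∣ ≤ ∣ B ∣
  ∣∣-drop []      A⊆B _ _ _ = p⊆q⇒∣p∣≤∣q∣ A⊆B
  ∣∣-drop {A} {B} (x ∷ L) A⊆B (x∉L ∷ u) (x∈B ∷ L⊆B) (x∉A ∷ L∉A) = ≤-trans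
    (s≤s (∣∣-drop L (λ {y} y∈A → x∈p∧x≢y⇒x∈p-y (A⊆B y∈A) λ { refl → x∉A y∈A }) u
      (All.zipWith (λ { (y∈B , x≢y) → x∈p∧x≢y⇒x∈p-y y∈B (x≢y ∘ ≡.sym) }) (L⊆B , x∉L)) L∉A))
    (x∈p⇒∣p-x∣<∣p∣ x∈B)

∣p∣≤1+∣p-x∣ : ∀ {n} (p : Subset n) x → ∣ p ∣ ≤ suc ∣ p - x ∣
∣p∣≤1+∣p-x∣ (inside  ∷ p) zero    = s≤s (≤-reflexive (cong ∣_∣ (≡.sym (p─⊥≡p p))))
∣p∣≤1+∣p-x∣ (outside ∷ p) zero    = m≤n⇒m≤1+n (≤-reflexive (cong ∣_∣ (≡.sym (p─⊥≡p p))))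
∣p∣≤1+∣p-x∣ (inside  ∷ p) (suc x) = s≤s (∣p∣≤1+∣p-x∣ p x)
∣p∣≤1+∣p-x∣ (outside ∷ p) (suc x) = ∣p∣≤1+∣p-x∣ p x

x∉p-x : ∀ {n} (p : Subset n) x → x ∉ p - x
x∉p-x (_ ∷ p) zero    ()
x∉p-x (_ ∷ p) (suc x) (Vec.there x∈) = x∉p-x p x x∈

∣∣-cover : ∀ {n} {A B : Subset n} L → (∀ {x} → x ∈ A → x ∈ B ⊎ x ∈ₗ L) → ∣ A ∣ ≤ length L + ∣ B ∣
∣∣-cover []      c = p⊆q⇒∣p∣≤∣q∣ (λ x∈A → [ id , (λ ()) ]′ (c x∈A))
∣∣-cover {A = A} {B} (x ∷ L) c = ≤-trans (∣p∣≤1+∣p-x∣ A x) (s≤s (∣∣-cover L cover))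
  where
  cover : ∀ {y} → y ∈ A - x → y ∈ B ⊎ y ∈ₗ L
  cover {y} y∈ with c (p─q⊆p A _ y∈)
  ... | inj₁ y∈B         = inj₁ y∈B
  ... | inj₂ (here refl) = ⊥-elim (x∉p-x A x y∈)
  ... | inj₂ (there y∈L) = inj₂ y∈L

Unique-⊆-length : ∀ {A : Set} {xs ys : List A} → Unique xs → (∀ {x} → x ∈ₗ xs → x ∈ₗ ys) → length xs ≤ length ys
Unique-⊆-length {xs = []} _ _ = z≤n
Unique-⊆-length {xs = x ∷ xs} {ys} (x∉xs ∷ u) sub = ≤-trans
  (s≤s (Unique-⊆-length u λ y∈ → remove (sub (here refl)) (sub (there y∈)) λ { refl → All.lookup x∉xs y∈ refl }))
  (≤-reflexive (length-remove (sub (here refl))))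
  where
  remove : ∀ {ys} {x y} (p : x ∈ₗ ys) → y ∈ₗ ys → y ≢ x → y ∈ₗ (ys Any.─ p)
  remove (here refl) (here refl) y≢x = ⊥-elim (y≢x refl)
  remove (here refl) (there q)   _   = q
  remove (there p)   (here refl) _   = here refl
  remove (there p)   (there q)   y≢x = there (remove p q y≢x)
  length-remove : ∀ {ys} {x} (p : x ∈ₗ ys) → suc (length (ys Any.─ p)) ≡ length ys
  length-remove (here _)  = refl
  length-remove (there p) = cong suc (length-remove p)

-- Each pair appears in one orientation only, so for a duplicate-free list the length is the number
-- of 2-subsets.
pairs : ∀ {A : Set} → List A → List (A × A)
pairs []       = []
pairs (x ∷ xs) = map (x ,_) xs ++ pairs xs

∈-pairs : ∀ {A : Set} {xs : List A} {x y} → x ∈ₗ xs → y ∈ₗ xs → x ≢ y → (x , y) ∈ₗ pairs xs ⊎ (y , x) ∈ₗ pairs xs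
∈-pairs (here refl) (here refl) x≢y = ⊥-elim (x≢y refl)
∈-pairs (here refl) (there q)   _   = inj₁ (∈-++⁺ˡ (∈-map⁺ _ q))
∈-pairs (there p)   (here refl) _   = inj₂ (∈-++⁺ˡ (∈-map⁺ _ p))
∈-pairs {xs = z ∷ xs} (there p) (there q) x≢y =
  Sum.map (∈-++⁺ʳ (map (z ,_) xs)) (∈-++⁺ʳ (map (z ,_) xs)) (∈-pairs p q x≢y)

∈-pairs⁻ : ∀ {A : Set} {xs : List A} {x y} → Unique xs → (x , y) ∈ₗ pairs xs → x ∈ₗ xs × y ∈ₗ xs × x ≢ y
∈-pairs⁻ {xs = z ∷ xs} (z∉ ∷ u) p with ∈-++⁻ (map (z ,_) xs) p
... | inj₁ q with y , y∈ , refl ← ∈-map⁻ (z ,_) q = here refl , there y∈ , All.lookup z∉ y∈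
... | inj₂ q with x∈ , y∈ , x≢y ← ∈-pairs⁻ u q = there x∈ , there y∈ , x≢y

-- Maximum dissociation sets of induced subgraphs

module Dissociation {n : ℕ} (G : Graph n) where

  infix 4 _~_ _~?_

  _~_ : Fin n → Fin n → Set
  _~_ = Adj G

  _~?_ : ∀ u v → Dec (u ~ v)
  u ~? v = adj G u v Bool.≟ true

  ~-sym : ∀ {u v} → u ~ v → v ~ u
  ~-sym {u} {v} = ≡.trans (Graph.sym G v u)

  ~-irrefl : ∀ {u v} → u ~ v → u ≢ v
  ~-irrefl {u} u~u refl with () ← ≡.trans (≡.sym u~u) (Graph.irrefl G u)

  Diss : Subset n → Set
  Diss = IsDissociation G

  record MaxIn (S F : Subset n) : Set where
    constructor maxIn
    field
      ⊆S      : F ⊆ S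
      diss    : Diss F
      largest : ∀ {F'} → F' ⊆ S → Diss F' → ∣ F' ∣ ≤ ∣ F ∣
  open MaxIn public

  Good : Subset n → Set
  Good S = Bounded 1 (10 ^ ∣ S ∣) 1 (MaxIn S)

  Separated : List (Fin n) → Subset n → Set
  Separated C S' = ∀ {c x} → c ∈ₗ C → x ∈ S' → c ≢ x × ¬ c ~ x

  -- No edge joins `C` to `S'`, so a competitor F' inside `S'` together with `C` is a dissociation
  -- set of G[S]; hence |F'| + |C| ≤ |F|.
  residual : ∀ {S F C S'} → MaxIn S F → Unique C → All (_∈ F) C → S' ⊆ S → Separated C S' →
    (∀ {x} → x ∈ F → x ∈ₗ C ⊎ x ∈ S') → MaxIn S' (F ∖ C)
  residual {S} {F} {C} {S'} M uC C⊆F S'⊆S sep cov = maxIn sub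
    (λ u v w u∈ v∈ w∈ → diss M u v w (proj₁ (∈-∖⁻ F C u∈)) (proj₁ (∈-∖⁻ F C v∈)) (proj₁ (∈-∖⁻ F C w∈)))
    best
    where
    sub : F ∖ C ⊆ S'
    sub x∈ with ∈-∖⁻ F C x∈
    ... | x∈F , x∉C with cov x∈F
    ... | inj₁ x∈C  = contradiction x∈C x∉C
    ... | inj₂ x∈S' = x∈S'
    best : ∀ {F'} → F' ⊆ S' → Diss F' → ∣ F' ∣ ≤ ∣ F ∖ C ∣
    best {F'} F'⊆S' dF' = +-cancelˡ-≤ (length C) _ _ (begin
      length C + ∣ F' ∣     ≤⟨ ∣∣-drop C (∈-⊕⁺ ∘ inj₁) uC (All.tabulate (∈-⊕⁺ ∘ inj₂))
                                 (All.tabulate λ c∈ c∈F' → proj₁ (sep c∈ (F'⊆S' c∈F')) refl) ⟩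
      ∣ F' ⊕ C ∣            ≤⟨ largest M ⊕⊆S ⊕-diss ⟩
      ∣ F ∣                 ≤⟨ ∣∣-cover C split-F ⟩
      length C + ∣ F ∖ C ∣  ∎)
      where
      open ≤-Reasoning
      ⊕⊆S : F' ⊕ C ⊆ S
      ⊕⊆S x∈ with ∈-⊕⁻ F' C x∈
      ... | inj₁ x∈F' = S'⊆S (F'⊆S' x∈F')
      ... | inj₂ x∈C  = ⊆S M (All.lookup C⊆F x∈C)
      split-F : ∀ {x} → x ∈ F → x ∈ F ∖ C ⊎ x ∈ₗ C
      split-F {x} x∈F with x ∈ₗ? C
      ... | yes x∈C = inj₂ x∈C
      ... | no x∉C  = inj₁ (∈-∖⁺ x∈F x∉C)
      inF' : ∀ {u v} → u ∈ F' → u ~ v → v ∈ F' ⊕ C → v ∈ F'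
      inF' u∈ u~v v∈ with ∈-⊕⁻ F' C v∈
      ... | inj₁ v∈F' = v∈F'
      ... | inj₂ v∈C  = contradiction (~-sym u~v) (proj₂ (sep v∈C (F'⊆S' u∈)))
      inC : ∀ {u v} → u ∈ₗ C → u ~ v → v ∈ F' ⊕ C → v ∈ F
      inC u∈ u~v v∈ with ∈-⊕⁻ F' C v∈
      ... | inj₁ v∈F' = contradiction u~v (proj₂ (sep u∈ (F'⊆S' v∈F')))
      ... | inj₂ v∈C  = All.lookup C⊆F v∈C
      ⊕-diss : Diss (F' ⊕ C)
      ⊕-diss u v w u∈ v∈ w∈ u~v u~w with ∈-⊕⁻ F' C u∈
      ... | inj₁ u∈F' = dF' u v w u∈F' (inF' u∈F' u~v v∈) (inF' u∈F' u~w w∈) u~v u~w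
      ... | inj₂ u∈C  = diss M u v w (All.lookup C⊆F u∈C) (inC u∈C u~v v∈) (inC u∈C u~w w∈) u~v u~w

  ∖-injective : ∀ {F F' : Subset n} {C} → All (_∈ F) C → All (_∈ F') C → F ∖ C ≡ F' ∖ C → F ≡ F'
  ∖-injective {F} {F'} {C} C⊆F C⊆F' eq = ⊆-antisym (half C⊆F' eq) (half C⊆F (≡.sym eq))
    where
    half : ∀ {F F' : Subset n} → All (_∈ F') C → F ∖ C ≡ F' ∖ C → F ⊆ F'
    half C⊆F' eq {x} x∈F with x ∈ₗ? C
    ... | yes x∈C = All.lookup C⊆F' x∈C
    ... | no x∉C  = proj₁ (∈-∖⁻ _ C (subst (x ∈_) eq (∈-∖⁺ x∈F x∉C)))

  -- F ∪ {x} would be a larger dissociation set.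
  no-augmentation : ∀ {S F x} → MaxIn S F → x ∈ S → x ∉ F →
    (∀ {y z} → y ∈ F → z ∈ F → x ~ y → x ~ z → y ≡ z) → (∀ {y z} → y ∈ F → z ∈ F → x ~ y → ¬ y ~ z) → ⊥
  no-augmentation {S} {F} {x} M x∈S x∉F one iso = <⇒≱ (∣∣-drop (x ∷ []) (∈-⊕⁺ ∘ inj₁) ([] ∷ [])
      (∈-⊕⁺ (inj₂ (here refl)) ∷ []) (x∉F ∷ [])) (largest M sub d)
    where
    sub : F ⊕ (x ∷ []) ⊆ S
    sub y∈ with ∈-⊕⁻ F (x ∷ []) y∈
    ... | inj₁ y∈F         = ⊆S M y∈F
    ... | inj₂ (here refl) = x∈S
    d : Diss (F ⊕ (x ∷ []))
    d u v w u∈ v∈ w∈ u~v u~w with ∈-⊕⁻ F (x ∷ []) u∈ | ∈-⊕⁻ F (x ∷ []) v∈ | ∈-⊕⁻ F (x ∷ []) w∈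
    ... | inj₁ a | inj₁ b | inj₁ c = diss M u v w a b c u~v u~w
    ... | inj₁ a | inj₂ (here refl) | inj₂ (here refl) = refl
    ... | inj₁ a | inj₁ b | inj₂ (here refl) = ⊥-elim (iso a b (~-sym u~w) u~v)
    ... | inj₁ a | inj₂ (here refl) | inj₁ c = ⊥-elim (iso a c (~-sym u~v) u~w)
    ... | inj₂ (here refl) | inj₁ b | inj₁ c = one b c u~v u~w
    ... | inj₂ (here refl) | inj₂ (here refl) | _ = ⊥-elim (~-irrefl u~v refl)
    ... | inj₂ (here refl) | _ | inj₂ (here refl) = ⊥-elim (~-irrefl u~w refl)

  -- A predicate on lists, not a fixed list: it is invariant under permutation, so any neighbour can
  -- be moved to the front.
  record Nbrs (S : Subset n) (v : Fin n) (L : List (Fin n)) : Set where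
    field
      unique   : Unique L
      sound    : ∀ {w} → w ∈ₗ L → w ∈ S × v ~ w
      complete : ∀ {w} → w ∈ S → v ~ w → w ∈ₗ L
  open Nbrs public

  nbrs : Subset n → Fin n → List (Fin n)
  nbrs S v = filter (λ w → (w ∈? S) ×-dec (v ~? w)) (allFin n)

  nbrs-Nbrs : ∀ S v → Nbrs S v (nbrs S v)
  nbrs-Nbrs S v = record
    { unique   = Unique.filter⁺ _ (Unique.allFin⁺ n)
    ; sound    = λ w∈ → proj₂ (∈-filter⁻ (λ w → (w ∈? S) ×-dec (v ~? w)) {xs = allFin n} w∈)
    ; complete = λ w∈S v~w → ∈-filter⁺ _ (∈-allFin _) (w∈S , v~w)
    }

  Isolated : Subset n → Fin n → Subset n → Set
  Isolated S v F = MaxIn S F × v ∈ F × (∀ {w} → w ∈ F → ¬ v ~ w)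

  -- Adjacency of `v` and `u` is left out so that the notion also covers the non-adjacent pairs
  -- inside a component whose complement is a matching.
  Both : Subset n → Fin n → Fin n → Subset n → Set
  Both S v u F = MaxIn S F × v ∈ F × u ∈ F

  Paired : Subset n → Fin n → List (Fin n) → Subset n → Set
  Paired S v L F = Any (λ u → Both S v u F) L

  isolated-or-paired : ∀ {S v L F} → Nbrs S v L → MaxIn S F → v ∈ F → Isolated S v F ⊎ Paired S v L F
  isolated-or-paired {S} {v} {L} {F} N M v∈F with Any.any? (_∈? F) L
  ... | yes some = inj₂ (Any.map (λ u∈F → M , v∈F , u∈F) some)
  ... | no none  = inj₁ (M , v∈F , λ w∈F v~w → none (Any.map (λ { refl → w∈F }) (complete N (⊆S M w∈F) v~w)))

  -- As `v` is isolated in F, the only neighbour of `u` in F is `v`; adding `u` would merely turn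
  -- `v` into the edge vu.
  isolated-nbr : ∀ {S v u F} → Isolated S v F → u ∈ S → v ~ u →
    (∀ {w} → w ∈ F → u ~ w → w ≡ v ⊎ v ~ w) → ⊥
  isolated-nbr {v = v} {u} {F} (M , v∈F , iso) u∈S v~u near =
    no-augmentation M u∈S (λ u∈F → iso u∈F v~u)
      (λ y∈ z∈ u~y u~z → ≡.trans (only y∈ u~y) (≡.sym (only z∈ u~z)))
      (λ { y∈ z∈ u~y y~z → iso z∈ (subst (_~ _) (only y∈ u~y) y~z) })
    where
    only : ∀ {w} → w ∈ F → u ~ w → w ≡ v
    only w∈ u~w with near w∈ u~w
    ... | inj₁ e   = e
    ... | inj₂ v~w = contradiction v~w (iso w∈)

  infixl 6 _∖N_

  opaque

    private
      ∖N? : ∀ (S : Subset n) C x → Dec (x ∈ S × All (λ c → c ≢ x × ¬ c ~ x) C)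
      ∖N? S C x = (x ∈? S) ×-dec All.all? (λ c → ¬? (c ≟ x) ×-dec ¬? (c ~? x)) C

    _∖N_ : Subset n → List (Fin n) → Subset n
    S ∖N C = select (∖N? S C)

    ∖N⊆ : ∀ {S C} → S ∖N C ⊆ S
    ∖N⊆ {S} {C} = proj₁ ∘ ∈-select⁻ (∖N? S C)

    ∈-∖N⁺ : ∀ {S C x} → x ∈ S → (∀ {c} → c ∈ₗ C → c ≢ x × ¬ c ~ x) → x ∈ S ∖N C
    ∈-∖N⁺ {S} {C} x∈S h = ∈-select⁺ (∖N? S C) (x∈S , All.tabulate h)

    ∖N-separated : ∀ {S C} → Separated C (S ∖N C)
    ∖N-separated {S} {C} c∈ x∈ = All.lookup (proj₂ (∈-select⁻ (∖N? S C) x∈)) c∈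

  -- Only an explicit list `R` of vertices of N[C] is counted. A lower bound on the loss is enough,
  -- and it need not be known which further vertices disappear.
  ∖N-drop : ∀ {S} C R → Unique R → All (_∈ S) R → All (λ r → Any (λ c → c ≡ r ⊎ c ~ r) C) R →
    length R + ∣ S ∖N C ∣ ≤ ∣ S ∣
  ∖N-drop {S} C R uR R⊆S near = ∣∣-drop R ∖N⊆ uR R⊆S (All.map out near)
    where
    out : ∀ {r} → Any (λ c → c ≡ r ⊎ c ~ r) C → r ∉ S ∖N C
    out near r∈ with find near
    ... | c , c∈ , inj₁ e   = proj₁ (∖N-separated c∈ r∈) e
    ... | c , c∈ , inj₂ c~r = proj₂ (∖N-separated c∈ r∈) c~r

  -- With `C` fixed, F is recovered from F ∖ C, so counting F reduces to counting the residual sets.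
  MaxIn-remove : ∀ {S} {K T p} {P Q : Subset n → Set} C → (∀ {F} → P F → MaxIn S F × All (_∈ F) C × Q (F ∖ C)) →
    Bounded K T p Q → Bounded K T p P
  MaxIn-remove C h = Bounded-injective (_∖ C) (λ p → proj₂ (proj₂ (h p)))
    (λ p q → ∖-injective (proj₁ (proj₂ (h p))) (proj₁ (proj₂ (h q))))

  isolated-residual : ∀ {S v F} → Isolated S v F → MaxIn (S ∖N (v ∷ [])) (F ∖ (v ∷ []))
  isolated-residual {S} {v} {F} (M , v∈F , iso) =
    residual M ([] ∷ []) (v∈F ∷ []) ∖N⊆ ∖N-separated cov
    where
    cov : ∀ {x} → x ∈ F → x ∈ₗ (v ∷ []) ⊎ x ∈ S ∖N (v ∷ [])
    cov {x} x∈F with x ≟ v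
    ... | yes refl = inj₁ (here refl)
    ... | no x≢v   = inj₂ (∈-∖N⁺ (⊆S M x∈F) λ { (here refl) → x≢v ∘ ≡.sym , iso x∈F })

  both-residual : ∀ {S v u F} → v ~ u → Both S v u F → MaxIn (S ∖N (v ∷ u ∷ [])) (F ∖ (v ∷ u ∷ []))
  both-residual {S} {v} {u} {F} v~u (M , v∈F , u∈F) =
    residual M ((~-irrefl v~u ∷ []) ∷ [] ∷ []) (v∈F ∷ u∈F ∷ []) ∖N⊆ ∖N-separated cov
    where
    cov : ∀ {x} → x ∈ F → x ∈ₗ (v ∷ u ∷ []) ⊎ x ∈ S ∖N (v ∷ u ∷ [])
    cov {x} x∈F with x ≟ v | x ≟ u
    ... | yes refl | _ = inj₁ (here refl)
    ... | no _ | yes refl = inj₁ (there (here refl))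
    ... | no x≢v | no x≢u = inj₂ (∈-∖N⁺ (⊆S M x∈F) λ
      { (here refl)         → x≢v ∘ ≡.sym , λ v~x → x≢u (diss M _ _ _ v∈F x∈F u∈F v~x v~u)
      ; (there (here refl)) → x≢u ∘ ≡.sym , λ u~x → x≢v (diss M _ _ _ u∈F x∈F v∈F u~x (~-sym v~u)) })

  absent-residual : ∀ {S v F} → MaxIn S F → v ∉ F → MaxIn (S ∖ (v ∷ [])) F
  absent-residual M v∉F = maxIn
    (λ x∈F → ∈-∖⁺ (⊆S M x∈F) λ { (here refl) → v∉F x∈F }) (diss M)
    (λ F'⊆ d → largest M (proj₁ ∘ ∈-∖⁻ _ _ ∘ F'⊆) d)

  -- Neighbours outside N[v], and degree conditions

  Closed : Subset n → Fin n → Fin n → Set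
  Closed S v u = ∀ {w} → w ∈ S → u ~ w → w ≡ v ⊎ v ~ w

  IsOuter : Subset n → Fin n → Fin n → Fin n → Set
  IsOuter S v u w = w ∈ S × u ~ w × w ≢ v × ¬ v ~ w

  -- The cases that matter for a neighbour `u` of `v`. With no outer vertex, `v` is never isolated
  -- in F; a single one lies in every F in which `v` is isolated; two of them make the pair v, u
  -- cost two more vertices.
  data Outer (S : Subset n) (v u : Fin n) : Set where
    none : Closed S v u → Outer S v u
    one  : ∀ w → IsOuter S v u w → (∀ {w'} → IsOuter S v u w' → w' ≡ w) → Outer S v u
    many : ∀ w w' → w ≢ w' → IsOuter S v u w → IsOuter S v u w' → Outer S v u

  outer? : ∀ S v u → Outer S v u
  outer? S v u = classify (filter isOuter? (allFin n)) (Unique.filter⁺ isOuter? (Unique.allFin⁺ n))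
      (λ w∈ → proj₂ (∈-filter⁻ isOuter? {xs = allFin n} w∈)) (λ o → ∈-filter⁺ isOuter? (∈-allFin _) o)
    where
    isOuter? : ∀ w → Dec (IsOuter S v u w)
    isOuter? w = (w ∈? S) ×-dec (u ~? w) ×-dec ¬? (w ≟ v) ×-dec ¬? (v ~? w)
    classify : ∀ l → Unique l → (∀ {w} → w ∈ₗ l → IsOuter S v u w) → (∀ {w} → IsOuter S v u w → w ∈ₗ l) → Outer S v u
    classify [] _ _ complete = none closed
      where
      closed : Closed S v u
      closed {w} w∈S u~w with w ≟ v | v ~? w
      ... | yes w≡v | _       = inj₁ w≡v
      ... | no _    | yes v~w = inj₂ v~w
      ... | no w≢v  | no v≁w  with () ← complete (w∈S , u~w , w≢v , v≁w)
    classify (w ∷ []) _ sound complete = one w (sound (here refl)) λ o → single (complete o)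
      where
      single : ∀ {w'} → w' ∈ₗ (w ∷ []) → w' ≡ w
      single (here e) = e
    classify (w ∷ w' ∷ _) ((w≢w' ∷ _) ∷ _) sound _ = many w w' w≢w' (sound (here refl)) (sound (there (here refl)))

  HasOuter : Subset n → Fin n → Fin n → Set
  HasOuter S v u = ∃ (IsOuter S v u)

  closed-or-open : ∀ S v u → Closed S v u ⊎ HasOuter S v u
  closed-or-open S v u with outer? S v u
  ... | none c           = inj₁ c
  ... | one w o _        = inj₂ (w , o)
  ... | many w _ _ o _   = inj₂ (w , o)

  -- In this form a contradiction needs only a list of d + 1 distinct neighbours.
  MaxDeg : ℕ → Subset n → Set
  MaxDeg d S = ∀ {v} R → v ∈ S → Unique R → All (λ w → w ∈ S × v ~ w) R → length R ≤ d

  MaxDeg-⊆ : ∀ {d S S'} → S' ⊆ S → MaxDeg d S → MaxDeg d S'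
  MaxDeg-⊆ sub Δ R v∈ u h = Δ R (sub v∈) u (All.map (λ (w∈ , v~w) → sub w∈ , v~w) h)

  Leaf : Subset n → Fin n → Fin n → Set
  Leaf S u o = u ∈ S × o ∈ S × u ~ o × (∀ {w} → w ∈ S → u ~ w → w ≡ o)

  -- Components whose complement is a matching

  -- The complement of G[K] has maximum degree at most 1.
  NoCherry : List (Fin n) → Set
  NoCherry K = ∀ {x y z} → x ∈ₗ K → y ∈ₗ K → z ∈ₗ K → x ≢ y → x ≢ z → y ≢ z → x ~ y ⊎ x ~ z

  ClosedUnder : Subset n → List (Fin n) → Set
  ClosedUnder S K = ∀ {x w} → x ∈ₗ K → w ∈ S → x ~ w → w ∈ₗ K

  ∖⊆ : ∀ (S : Subset n) C → S ∖ C ⊆ S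
  ∖⊆ S C x∈ = proj₁ (∈-∖⁻ S C x∈)

  ∖-drop : ∀ {S} C → Unique C → All (_∈ S) C → length C + ∣ S ∖ C ∣ ≤ ∣ S ∣
  ∖-drop {S} C uC C⊆S = ∣∣-drop C (∖⊆ S C) uC C⊆S (All.tabulate λ c∈ c∈S' → proj₂ (∈-∖⁻ S C c∈S') c∈)

  -- If F met `K` in at most one vertex, any other vertex of `K` could be added: all its neighbours
  -- lie in `K`, so at most one edge arises.
  two-from-component : ∀ {S K F x₀ y₀} → MaxIn S F → All (_∈ S) K → ClosedUnder S K → NoCherry K →
    x₀ ∈ₗ K → y₀ ∈ₗ K → x₀ ≢ y₀ → Any (λ (x , y) → Both S x y F) (pairs K)
  two-from-component {S} {K} {F} {x₀} {y₀} M K⊆S clo nc x₀∈ y₀∈ x₀≢y₀ = both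
    where
    another : ∀ {x} → x ∈ₗ K → x ∈ F → ∃ λ y → y ∈ₗ K × y ∈ F × x ≢ y
    another {x} x∈K x∈F with Any.any? (λ y → (y ∈? F) ×-dec ¬? (x ≟ y)) K
    ... | yes p with y , y∈K , y∈F , x≢y ← find p = y , y∈K , y∈F , x≢y
    ... | no ¬p = ⊥-elim (augment (other x₀∈ y₀∈ x₀≢y₀))
      where
      only : ∀ {z} → z ∈ₗ K → z ∈ F → z ≡ x
      only {z} z∈K z∈F with x ≟ z
      ... | yes refl = refl
      ... | no x≢z   = ⊥-elim (¬p (lose z∈K (z∈F , x≢z)))
      other : ∀ {a b} → a ∈ₗ K → b ∈ₗ K → a ≢ b → ∃ λ y → y ∈ₗ K × y ∉ F
      other {a} {b} a∈ b∈ a≢b with a ∈? F | b ∈? F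
      ... | no a∉  | _      = a , a∈ , a∉
      ... | yes _  | no b∉  = b , b∈ , b∉
      ... | yes a∈F | yes b∈F = ⊥-elim (a≢b (≡.trans (only a∈ a∈F) (≡.sym (only b∈ b∈F))))
      augment : (∃ λ y → y ∈ₗ K × y ∉ F) → ⊥
      augment (y , y∈K , y∉F) = no-augmentation M (All.lookup K⊆S y∈K) y∉F
        (λ a∈ b∈ y~a y~b → ≡.trans (at a∈ y~a) (≡.sym (at b∈ y~b)))
        (λ a∈ b∈ y~a a~b → ~-irrefl a~b (≡.trans (at a∈ y~a) (≡.sym (only (clo (clo y∈K (⊆S M a∈) y~a) (⊆S M b∈) a~b) b∈))))
        where
        at : ∀ {a} → a ∈ F → y ~ a → a ≡ x
        at a∈ y~a = only (clo y∈K (⊆S M a∈) y~a) a∈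
    from : ∀ {x} → x ∈ₗ K → x ∈ F → Any (λ (x , y) → Both S x y F) (pairs K)
    from x∈K x∈F with y , y∈K , y∈F , x≢y ← another x∈K x∈F with ∈-pairs x∈K y∈K x≢y
    ... | inj₁ p = lose p (M , x∈F , y∈F)
    ... | inj₂ p = lose p (M , y∈F , x∈F)
    both : Any (λ (x , y) → Both S x y F) (pairs K)
    both with Any.any? (_∈? F) K
    ... | yes p with x , x∈K , x∈F ← find p = from x∈K x∈F
    ... | no ¬p = ⊥-elim (no-augmentation M (All.lookup K⊆S x₀∈) (λ x₀∈F → ¬p (lose x₀∈ x₀∈F))
        (λ a∈ _ x~a _ → ⊥-elim (¬p (lose (clo x₀∈ (⊆S M a∈) x~a) a∈)))
        (λ a∈ _ x~a _ → ⊥-elim (¬p (lose (clo x₀∈ (⊆S M a∈) x~a) a∈))))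

  -- Among three vertices of `K` at most one edge is missing, so two edges remain and share a
  -- vertex.
  no-three : ∀ {K F x y z} → NoCherry K → Diss F → x ∈ₗ K → y ∈ₗ K → z ∈ₗ K → x ∈ F → y ∈ F → z ∈ F →
    x ≢ y → x ≢ z → y ≢ z → ⊥
  no-three nc d x∈K y∈K z∈K x∈F y∈F z∈F x≢y x≢z y≢z
    with nc x∈K y∈K z∈K x≢y x≢z y≢z | nc y∈K x∈K z∈K (x≢y ∘ ≡.sym) y≢z x≢z
       | nc z∈K x∈K y∈K (x≢z ∘ ≡.sym) (y≢z ∘ ≡.sym) x≢y
  ... | inj₁ x~y | inj₁ _   | inj₁ z~x = y≢z (d _ _ _ x∈F y∈F z∈F x~y (~-sym z~x))
  ... | inj₁ x~y | inj₁ _   | inj₂ z~y = x≢z (d _ _ _ y∈F x∈F z∈F (~-sym x~y) (~-sym z~y))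
  ... | inj₁ x~y | inj₂ y~z | _        = x≢z (d _ _ _ y∈F x∈F z∈F (~-sym x~y) y~z)
  ... | inj₂ x~z | inj₁ y~x | _        = y≢z (d _ _ _ x∈F y∈F z∈F (~-sym y~x) x~z)
  ... | inj₂ x~z | inj₂ y~z | _        = x≢y (d _ _ _ z∈F x∈F y∈F (~-sym x~z) (~-sym y~z))

  component-residual : ∀ {S K F x y} → ClosedUnder S K → NoCherry K →
    x ∈ₗ K → y ∈ₗ K → x ≢ y → Both S x y F → MaxIn (S ∖ K) (F ∖ (x ∷ y ∷ []))
  component-residual {S} {K} {F} {x} {y} clo nc x∈K y∈K x≢y (M , x∈F , y∈F) =
    residual M ((x≢y ∷ []) ∷ [] ∷ []) (x∈F ∷ y∈F ∷ []) (∖⊆ S K) (λ c∈ → sep (inK c∈)) cov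
    where
    inK : ∀ {c} → c ∈ₗ (x ∷ y ∷ []) → c ∈ₗ K
    inK (here refl)         = x∈K
    inK (there (here refl)) = y∈K
    sep : ∀ {c z} → c ∈ₗ K → z ∈ S ∖ K → c ≢ z × ¬ c ~ z
    sep c∈ z∈ with ∈-∖⁻ S K z∈
    ... | z∈S , z∉K = (λ { refl → z∉K c∈ }) , λ c~z → z∉K (clo c∈ z∈S c~z)
    cov : ∀ {z} → z ∈ F → z ∈ₗ (x ∷ y ∷ []) ⊎ z ∈ S ∖ K
    cov {z} z∈F with x ≟ z | y ≟ z | z ∈ₗ? K
    ... | yes refl | _        | _      = inj₁ (here refl)
    ... | no _     | yes refl | _      = inj₁ (there (here refl))
    ... | no _     | no _     | no z∉K = inj₂ (∈-∖⁺ (⊆S M z∈F) z∉K)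
    ... | no x≢z   | no y≢z   | yes z∈K = ⊥-elim (no-three nc (diss M) x∈K y∈K z∈K x∈F y∈F z∈F x≢y x≢z y≢z)

  -- F meets `K` in one of its pairs, and removing that pair leaves a maximum set of G[S - K].
  component-bounded : ∀ {S K k T x₀ y₀} .{{_ : NonZero k}} → Unique K → All (_∈ S) K → ClosedUnder S K → NoCherry K →
    x₀ ∈ₗ K → y₀ ∈ₗ K → x₀ ≢ y₀ → Bounded k T 1 (MaxIn (S ∖ K)) → Bounded k T (length (pairs K)) (MaxIn S)
  component-bounded {S} {K} uK K⊆S clo nc x₀∈ y₀∈ x₀≢y₀ b =
    Bounded-⊆ (λ M → two-from-component M K⊆S clo nc x₀∈ y₀∈ x₀≢y₀)
      (Bounded-Any (pairs K) λ (x , y) p → let (x∈ , y∈ , x≢y) = ∈-pairs⁻ uK p in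
        MaxIn-remove (x ∷ y ∷ []) (λ B@(M , x∈F , y∈F) → M , x∈F ∷ y∈F ∷ [] , component-residual clo nc x∈ y∈ x≢y B) b)

  -- A set containing the dominating vertex v of a component K has at most two vertices in K, so it could
  -- be enlarged by exchanging them for a cherry of the complement.
  cherry-absent : ∀ {S K F v} → MaxIn S F → All (_∈ S) K → ClosedUnder S K → v ∈ₗ K →
    (∀ {u} → u ∈ₗ K → u ≢ v → v ~ u) → ∀ {x y z} → x ∈ₗ K → y ∈ₗ K → z ∈ₗ K → x ≢ y → x ≢ z → y ≢ z →
    ¬ x ~ y → ¬ x ~ z → v ∉ F
  cherry-absent {S} {K} {F} {v} M K⊆S clo v∈K dom {x} {y} {z} x∈ y∈ z∈ x≢y x≢z y≢z x≁y x≁z v∈F =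
    <⇒≱ big (largest M sub d)
    where
    C = x ∷ y ∷ z ∷ []
    F' = F ∖ K ⊕ C
    inK : ∀ {c} → c ∈ₗ C → c ∈ₗ K
    inK (here refl)                 = x∈
    inK (there (here refl))         = y∈
    inK (there (there (here refl))) = z∈
    sub : F' ⊆ S
    sub w∈ with ∈-⊕⁻ (F ∖ K) C w∈
    ... | inj₁ w∈' = ⊆S M (∖⊆ F K w∈')
    ... | inj₂ w∈C = All.lookup K⊆S (inK w∈C)
    toF : ∀ {u w} → u ∈ F ∖ K → w ∈ F' → u ~ w → w ∈ F
    toF u∈ w∈ u~w with ∈-⊕⁻ (F ∖ K) C w∈
    ... | inj₁ w∈' = ∖⊆ F K w∈'
    ... | inj₂ w∈C = ⊥-elim (proj₂ (∈-∖⁻ F K u∈) (clo (inK w∈C) (⊆S M (∖⊆ F K u∈)) (~-sym u~w)))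
    toC : ∀ {u w} → u ∈ₗ K → w ∈ F' → u ~ w → w ∈ₗ C
    toC u∈ w∈ u~w with ∈-⊕⁻ (F ∖ K) C w∈
    ... | inj₁ w∈' = ⊥-elim (proj₂ (∈-∖⁻ F K w∈') (clo u∈ (⊆S M (∖⊆ F K w∈')) u~w))
    ... | inj₂ w∈C = w∈C
    xnone : ∀ {w} → w ∈ₗ C → ¬ x ~ w
    xnone (here refl)                 x~x = ~-irrefl x~x refl
    xnone (there (here refl))         = x≁y
    xnone (there (there (here refl))) = x≁z
    yonly : ∀ {w} → w ∈ₗ C → y ~ w → w ≡ z
    yonly (here refl)                 y~x = ⊥-elim (x≁y (~-sym y~x))
    yonly (there (here refl))         y~y = ⊥-elim (~-irrefl y~y refl)
    yonly (there (there (here refl))) _   = refl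
    zonly : ∀ {w} → w ∈ₗ C → z ~ w → w ≡ y
    zonly (here refl)                 z~x = ⊥-elim (x≁z (~-sym z~x))
    zonly (there (here refl))         _   = refl
    zonly (there (there (here refl))) z~z = ⊥-elim (~-irrefl z~z refl)
    d : Diss F'
    d a b c a∈ b∈ c∈ a~b a~c with ∈-⊕⁻ (F ∖ K) C a∈
    ... | inj₁ a∈' = diss M a b c (∖⊆ F K a∈') (toF a∈' b∈ a~b) (toF a∈' c∈ a~c) a~b a~c
    ... | inj₂ (here refl) = ⊥-elim (xnone (toC x∈ b∈ a~b) a~b)
    ... | inj₂ (there (here refl)) = ≡.trans (yonly (toC y∈ b∈ a~b) a~b) (≡.sym (yonly (toC y∈ c∈ a~c) a~c))
    ... | inj₂ (there (there (here refl))) = ≡.trans (zonly (toC z∈ b∈ a~b) a~b) (≡.sym (zonly (toC z∈ c∈ a~c) a~c))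
    large : 3 + ∣ F ∖ K ∣ ≤ ∣ F' ∣
    large = ∣∣-drop C (∈-⊕⁺ ∘ inj₁) ((x≢y ∷ x≢z ∷ []) ∷ (y≢z ∷ []) ∷ [] ∷ [])
      (All.tabulate (∈-⊕⁺ ∘ inj₂)) (All.tabulate λ c∈ c∈F → proj₂ (∈-∖⁻ F K c∈F) (inK c∈))
    small : ∣ F ∣ ≤ 2 + ∣ F ∖ K ∣
    small with Any.any? (λ u → (u ∈? F) ×-dec ¬? (u ≟ v)) K
    ... | no ¬p = m≤n⇒m≤1+n (∣∣-cover (v ∷ []) cov)
      where
      cov : ∀ {w} → w ∈ F → w ∈ F ∖ K ⊎ w ∈ₗ (v ∷ [])
      cov {w} w∈F with w ∈ₗ? K | w ≟ v
      ... | no w∉K | _        = inj₁ (∈-∖⁺ w∈F w∉K)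
      ... | yes _  | yes refl = inj₂ (here refl)
      ... | yes w∈K | no w≢v  = ⊥-elim (¬p (lose w∈K (w∈F , w≢v)))
    ... | yes p with u , u∈K , u∈F , u≢v ← find p = ∣∣-cover (v ∷ u ∷ []) cov
      where
      cov : ∀ {w} → w ∈ F → w ∈ F ∖ K ⊎ w ∈ₗ (v ∷ u ∷ [])
      cov {w} w∈F with w ∈ₗ? K | w ≟ v
      ... | no w∉K | _        = inj₁ (∈-∖⁺ w∈F w∉K)
      ... | yes _  | yes refl = inj₂ (here refl)
      ... | yes w∈K | no w≢v  = inj₂ (there (here (diss M v w u v∈F w∈F u∈F (dom w∈K w≢v) (dom u∈K u≢v))))
    big : ∣ F ∣ < ∣ F' ∣
    big = ≤-trans (s≤s small) large

  cherry? : ∀ K → NoCherry K ⊎ (∃ λ x → ∃ λ y → ∃ λ z → x ∈ₗ K × y ∈ₗ K × z ∈ₗ K × x ≢ y × x ≢ z × y ≢ z × ¬ x ~ y × ¬ x ~ z)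
  cherry? K with Any.any? (λ x → Any.any? (λ y → Any.any? (λ z →
      ¬? (x ≟ y) ×-dec ¬? (x ≟ z) ×-dec ¬? (y ≟ z) ×-dec ¬? (x ~? y) ×-dec ¬? (x ~? z)) K) K) K
  ... | yes p with x , x∈ , p' ← find p with y , y∈ , p″ ← find p' with z , z∈ , h ← find p″ =
    inj₂ (x , y , z , x∈ , y∈ , z∈ , h)
  ... | no ¬p = inj₁ nc
    where
    nc : NoCherry K
    nc {x} {y} {z} x∈ y∈ z∈ x≢y x≢z y≢z with x ~? y | x ~? z
    ... | yes x~y | _       = inj₁ x~y
    ... | no _    | yes x~z = inj₂ x~z
    ... | no x≁y  | no x≁z  = ⊥-elim (¬p (lose x∈ (lose y∈ (lose z∈ (x≢y , x≢z , y≢z , x≁y , x≁z)))))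

-- Weights in the recurrence at a vertex

module _ {n : ℕ} (G : Graph n) where
  open Dissociation G

  module Step (S : Subset n) (ih : ∀ S' → ∣ S' ∣ < ∣ S ∣ → Good S') where

    -- At most d · 10^((∣ S ∣ - k) / 5) sets satisfy P.
    Weighted : ℕ → ℕ → (Subset n → Set) → Set
    Weighted k d P = Bounded (10 ^ k) (10 ^ ∣ S ∣) d P

    Rare : ℕ → (Subset n → Set) → Set
    Rare = Few ∣ S ∣

    module _ {P : Subset n → Set} where

      rare-weight : ∀ k d p → T (d ^ 5 * scale ≤ᵇ p ^ 5 * 10 ^ k) → Weighted k d P → Rare p P
      rare-weight = Few-weight {m = ∣ S ∣}

      rare-mono : ∀ {p q} → T (p ≤ᵇ q) → Rare p P → Rare q P
      rare-mono {p} {q} c = Few-mono {m = ∣ S ∣} (≤ᵇ⇒≤ p q c)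

      rare-many : ∀ d a p → 5 ≤ d → T (5 ^ 5 * scale ≤ᵇ p ^ 5 * 10 ^ (5 + a)) → Weighted (d + a) d P → Rare p P
      rare-many = Few-many {m = ∣ S ∣}

      rare-shift : ∀ (S' : Subset n) {p'} k p → T (p' ^ 5 ≤ᵇ p ^ 5 * 10 ^ k) → k + ∣ S' ∣ ≤ ∣ S ∣ → Few ∣ S' ∣ p' P → Rare p P
      rare-shift S' {p'} k p = Few-shift {m = ∣ S ∣} {∣ S' ∣} {p'} k p

    residual-weighted : ∀ {S'} k → suc k + ∣ S' ∣ ≤ ∣ S ∣ → Weighted (suc k) 1 (MaxIn S')
    residual-weighted {S'} k le = Bounded-rescale
      (subst (λ z → z * 10 ^ suc k ≤ 1 * 10 ^ ∣ S ∣ * 1) (≡.sym (*-identityˡ (10 ^ ∣ S' ∣)))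
        (subst (10 ^ ∣ S' ∣ * 10 ^ suc k ≤_) (≡.sym (≡.trans (*-identityʳ _) (*-identityˡ (10 ^ ∣ S ∣))))
          (subst (_≤ 10 ^ ∣ S ∣) (≡.trans (^-distribˡ-+-* 10 (suc k) ∣ S' ∣) (*-comm (10 ^ suc k) _)) (^-monoʳ-≤ 10 le))))
      (ih S' (≤-trans (s≤s (m≤n+m ∣ S' ∣ k)) le))

    isolated-weighted : ∀ {v} R₀ → v ∈ S → Unique (v ∷ R₀) → All (λ w → w ∈ S × v ~ w) R₀ →
      Weighted (suc (length R₀)) 1 (Isolated S v)
    isolated-weighted {v} R₀ v∈S u h = MaxIn-remove (v ∷ [])
      (λ I@(M , v∈F , _) → M , v∈F ∷ [] , isolated-residual I)
      (residual-weighted (length R₀) (∖N-drop (v ∷ []) (v ∷ R₀) u (v∈S ∷ All.map proj₁ h)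
        (here (inj₁ refl) ∷ All.map (λ (_ , v~w) → here (inj₂ v~w)) h)))

    -- The list `R₀` is meant to include `u`, which counts as a neighbour of `v`; only `v` is added
    -- separately.
    both-weighted : ∀ {v u} R₀ → v ∈ S → v ~ u → Unique (v ∷ R₀) → All (λ w → w ∈ S × (v ~ w ⊎ u ~ w)) R₀ →
      Weighted (suc (length R₀)) 1 (Both S v u)
    both-weighted {v} {u} R₀ v∈S v~u uR h = MaxIn-remove (v ∷ u ∷ [])
      (λ B@(M , v∈F , u∈F) → M , v∈F ∷ u∈F ∷ [] , both-residual v~u B)
      (residual-weighted (length R₀) (∖N-drop (v ∷ u ∷ []) (v ∷ R₀) uR (v∈S ∷ All.map proj₁ h)
        (here (inj₁ refl) ∷ All.map (λ { (_ , inj₁ v~w) → here (inj₂ v~w) ; (_ , inj₂ u~w) → there (here (inj₂ u~w)) }) h)))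

    module _ {v L} (v∈S : v ∈ S) (N : Nbrs S v L) where

      v∷L-unique : Unique (v ∷ L)
      v∷L-unique = All.tabulate (λ w∈ → ~-irrefl (proj₂ (sound N w∈))) ∷ unique N

      isolated-at : Weighted (suc (length L)) 1 (Isolated S v)
      isolated-at = isolated-weighted L v∈S v∷L-unique (All.tabulate (sound N))

      no-isolated : ∀ {u} → u ∈ₗ L → Closed S v u → Rare 0 (Isolated S v)
      no-isolated u∈ c = Bounded-⊥ λ I@(M , _) → isolated-nbr I (proj₁ (sound N u∈)) (proj₂ (sound N u∈))
        λ w∈F → c (⊆S M w∈F)

      both-at : ∀ {u} → u ∈ₗ L → Weighted (suc (length L)) 1 (Both S v u)
      both-at u∈ = both-weighted L v∈S (proj₂ (sound N u∈)) v∷L-unique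
        (All.tabulate λ w∈ → proj₁ (sound N w∈) , inj₁ (proj₂ (sound N w∈)))

      outer∉ : ∀ {u w} → IsOuter S v u w → All (w ≢_) L
      outer∉ (_ , _ , _ , v≁w) = All.tabulate λ { w∈ refl → v≁w (proj₂ (sound N w∈)) }

      both-at-open : ∀ {u} → u ∈ₗ L → HasOuter S v u → Weighted (2 + length L) 1 (Both S v u)
      both-at-open u∈ (w , o@(w∈S , u~w , w≢v , _)) = both-weighted (w ∷ L) v∈S (proj₂ (sound N u∈))
        (((w≢v ∘ ≡.sym) ∷ AllPairs.head v∷L-unique) ∷ outer∉ o ∷ unique N)
        ((w∈S , inj₂ u~w) ∷ All.tabulate λ x∈ → proj₁ (sound N x∈) , inj₁ (proj₂ (sound N x∈)))

      both-at-many : ∀ {u w w'} → u ∈ₗ L → w ≢ w' → IsOuter S v u w → IsOuter S v u w' →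
        Weighted (3 + length L) 1 (Both S v u)
      both-at-many {w = w} {w'} u∈ w≢w' o@(w∈S , u~w , w≢v , _) o'@(w'∈S , u~w' , w'≢v , _) =
        both-weighted (w ∷ w' ∷ L) v∈S (proj₂ (sound N u∈))
          (((w≢v ∘ ≡.sym) ∷ (w'≢v ∘ ≡.sym) ∷ AllPairs.head v∷L-unique)
            ∷ (w≢w' ∷ outer∉ o) ∷ outer∉ o' ∷ unique N)
          ((w∈S , inj₂ u~w) ∷ (w'∈S , inj₂ u~w') ∷ All.tabulate λ x∈ → proj₁ (sound N x∈) , inj₁ (proj₂ (sound N x∈)))

      paired-at : Weighted (suc (length L)) (length L) (Paired S v L)
      paired-at = Bounded-Any {{m^n≢0 10 (suc (length L))}} L λ u u∈ → both-at u∈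

      paired-at-open : All (HasOuter S v) L → Weighted (2 + length L) (length L) (Paired S v L)
      paired-at-open o = Bounded-Any {{m^n≢0 10 (2 + length L)}} L λ u u∈ → both-at-open u∈ (All.lookup o u∈)

      present-bound : ∀ {p q} → Rare p (Isolated S v) → Rare q (Paired S v L) →
        Rare (p + q) (λ F → MaxIn S F × v ∈ F)
      present-bound i b = Bounded-⊆ (λ (M , v∈F) → isolated-or-paired N M v∈F)
        (Bounded-⊎ {{m^n≢0 unit 5}} i b)

    absent-bound : ∀ {v p'} p → v ∈ S → T (p' ^ 5 ≤ᵇ p ^ 5 * 10 ^ 1) → Few ∣ S ∖ (v ∷ []) ∣ p' (MaxIn (S ∖ (v ∷ []))) →
      Rare p (λ F → MaxIn S F × v ∉ F)
    absent-bound {v} {p'} p v∈S c b = Bounded-⊆ (λ (M , v∉F) → absent-residual M v∉F)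
      (rare-shift (S ∖ (v ∷ [])) {p'} 1 p c (∖-drop (v ∷ []) ([] ∷ []) (v∈S ∷ [])) b)

    absent-at : ∀ {v} → v ∈ S → Rare 630958 (λ F → MaxIn S F × v ∉ F)
    absent-at {v} v∈S = Bounded-⊆ (λ (M , v∉F) → absent-residual M v∉F)
      (rare-weight 1 1 _ tt (residual-weighted 0 (∖-drop (v ∷ []) ([] ∷ []) (v∈S ∷ []))))

    total : ∀ {v p q} → Rare p (λ F → MaxIn S F × v ∉ F) → Rare q (λ F → MaxIn S F × v ∈ F) → Rare (p + q) (MaxIn S)
    total {v} a b = Bounded-⊆ (λ {F} M → cases M (v ∈? F)) (Bounded-⊎ {{m^n≢0 unit 5}} a b)
      where
      cases : ∀ {F} → MaxIn S F → Dec (v ∈ F) → MaxIn S F × v ∉ F ⊎ MaxIn S F × v ∈ F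
      cases M (yes v∈F) = inj₂ (M , v∈F)
      cases M (no v∉F)  = inj₁ (M , v∉F)

    closed-or-all-open : ∀ v L → (∃ λ u → u ∈ₗ L × Closed S v u) ⊎ All (HasOuter S v) L
    closed-or-all-open v [] = inj₂ []
    closed-or-all-open v (u ∷ L) with closed-or-open S v u | closed-or-all-open v L
    ... | inj₁ c | _ = inj₁ (u , here refl , c)
    ... | inj₂ o | inj₁ (u' , u'∈ , c) = inj₁ (u' , there u'∈ , c)
    ... | inj₂ o | inj₂ os = inj₂ (o ∷ os)

    _∪ᴿ_ : ∀ {p q P Q} → Rare p P → Rare q Q → Rare (p + q) (λ F → P F ⊎ Q F)
    a ∪ᴿ b = Bounded-⊎ {{m^n≢0 unit 5}} a b

    -- At degree 5 the plain terms 0.630958 + 0.063096 + 0.315480 exceed 1. A closed neighbour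
    -- removes the second; if there is none, every pair loses one more vertex and the third drops to
    -- 0.199055.
    high-degree : ∀ {v L} → v ∈ S → Nbrs S v L → 5 ≤ length L → Rare 999999 (MaxIn S)
    high-degree {v} {L} v∈S N 5≤ with closed-or-all-open v L
    ... | inj₁ (u , u∈ , c) = rare-mono tt (total (absent-at v∈S) (present-bound v∈S N (no-isolated v∈S N u∈ c)
        (rare-many (length L) 1 315480 5≤ tt
          (subst (λ z → Weighted z (length L) (Paired S v L)) (+-comm 1 (length L)) (paired-at v∈S N)))))
    ... | inj₂ os = rare-mono tt (total (absent-at v∈S) (present-bound v∈S N (isolated-few N 5≤)
        (rare-many (length L) 2 199055 5≤ tt
          (subst (λ z → Weighted z (length L) (Paired S v L)) (+-comm 2 (length L)) (paired-at-open v∈S N os)))))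
      where
      isolated-few : ∀ {L} → Nbrs S v L → 5 ≤ length L → Rare 63096 (Isolated S v)
      isolated-few {a ∷ b ∷ c ∷ d ∷ e ∷ L'} N' (s≤s (s≤s (s≤s (s≤s (s≤s _))))) with unique N' | sound N'
      ... | (p ∷ q ∷ r ∷ s ∷ _) ∷ (p' ∷ q' ∷ r' ∷ _) ∷ (p″ ∷ q″ ∷ _) ∷ (p‴ ∷ _) ∷ _ | snd =
        rare-weight 6 1 _ tt (isolated-weighted (a ∷ b ∷ c ∷ d ∷ e ∷ []) v∈S
          (AllPairs.head (Unique.take⁺ 6 (v∷L-unique v∈S N')) ∷
           (p ∷ q ∷ r ∷ s ∷ []) ∷ (p' ∷ q' ∷ r' ∷ []) ∷ (p″ ∷ q″ ∷ []) ∷ (p‴ ∷ []) ∷ [] ∷ [])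
          (All.tabulate λ w∈ → snd (∈-++⁺ˡ w∈)))

    -- Maximality puts an isolated vertex into every F, so there is no term for its absence.
    isolated-vertex : ∀ {v} → v ∈ S → Nbrs S v [] → Rare 630958 (MaxIn S)
    isolated-vertex {v} v∈S N = Bounded-⊆ lonely (rare-weight 1 1 _ tt (isolated-at v∈S N))
      where
      lonely : ∀ {F} → MaxIn S F → Isolated S v F
      lonely {F} M = M , present , λ w∈F v~w → none' (complete N (⊆S M w∈F) v~w)
        where
        none' : ∀ {w} → w ∈ₗ [] → ⊥
        none' ()
        present : v ∈ F
        present with v ∈? F
        ... | yes v∈F = v∈F
        ... | no v∉F  = ⊥-elim (no-augmentation M v∈S v∉F
          (λ y∈ _ v~y → ⊥-elim (none' (complete N (⊆S M y∈) v~y))) (λ y∈ _ v~y → ⊥-elim (none' (complete N (⊆S M y∈) v~y))))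

    -- If o ∈ F then o has a partner in F, since otherwise its leaf u could be added.
    leaf-bound : ∀ {u o} → MaxDeg 3 S → Leaf S u o → Rare 900486 (MaxIn S)
    leaf-bound {u} {o} Δ (u∈S , o∈S , u~o , only) = Bounded-⊆ cases (isolated-u ∪ᴿ paired-o)
      where
      L = nbrs S o
      N = nbrs-Nbrs S o
      isolated-u : Rare 398108 (Isolated S u)
      isolated-u = rare-weight 2 1 _ tt (isolated-weighted (o ∷ []) u∈S ((~-irrefl u~o ∷ []) ∷ [] ∷ []) ((o∈S , u~o) ∷ []))
      -- For d ≤ 3 the term d · 10^(-(d+1)/5) is largest at d = 2, where it is 2 · 0.251189.
      paired-o : Rare 502378 (Paired S o L)
      paired-o with nbrs S o | nbrs-Nbrs S o | Δ (nbrs S o) o∈S (unique N) (All.tabulate (sound N))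
      ... | []              | N' | _ = rare-mono tt (Bounded-⊥ λ ())
      ... | _ ∷ []          | N' | _ = rare-weight 2 1 _ tt (paired-at o∈S N')
      ... | _ ∷ _ ∷ []      | N' | _ = rare-weight 3 2 _ tt (paired-at o∈S N')
      ... | _ ∷ _ ∷ _ ∷ []  | N' | _ = rare-weight 4 3 _ tt (paired-at o∈S N')
      ... | _ ∷ _ ∷ _ ∷ _ ∷ _ | _ | s≤s (s≤s (s≤s ()))
      cases : ∀ {F} → MaxIn S F → Isolated S u F ⊎ Paired S o L F
      cases {F} M with o ∈? F
      ... | yes o∈F with isolated-or-paired N M o∈F
      ...   | inj₂ p = inj₂ p
      ...   | inj₁ I = ⊥-elim (isolated-nbr I u∈S (~-sym u~o) λ w∈F u~w → inj₁ (only (⊆S M w∈F) u~w))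
      cases {F} M | no o∉F with u ∈? F
      ... | yes u∈F = inj₁ (M , u∈F , λ w∈F u~w → o∉F (subst (_∈ F) (only (⊆S M w∈F) u~w) w∈F))
      ... | no u∉F = ⊥-elim (no-augmentation M u∈S u∉F
          (λ y∈ _ u~y → ⊥-elim (o∉F (subst (_∈ F) (only (⊆S M y∈) u~y) y∈)))
          (λ y∈ _ u~y → ⊥-elim (o∉F (subst (_∈ F) (only (⊆S M y∈) u~y) y∈))))

    -- The worst case is 0.398108 + 0.251189: a single neighbour, which itself has an outer
    -- neighbour. This serves for a vertex that is known to lie in F.
    present-few : ∀ {v} → v ∈ S → length (nbrs S v) ≤ 2 → Rare 649297 (λ F → MaxIn S F × v ∈ F)
    present-few {v} v∈S le with nbrs S v | nbrs-Nbrs S v | le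
    ... | [] | N | _ = rare-mono tt (present-bound v∈S N (rare-weight 1 1 630958 tt (isolated-at v∈S N)) (Bounded-⊥ λ ()))
    ... | a ∷ [] | N | _ with closed-or-all-open v (a ∷ [])
    ...   | inj₁ (u , u∈ , c) = rare-mono tt (present-bound v∈S N (no-isolated v∈S N u∈ c) (rare-weight 2 1 398108 tt (paired-at v∈S N)))
    ...   | inj₂ os = present-bound v∈S N (rare-weight 2 1 398108 tt (isolated-at v∈S N)) (rare-weight 3 1 251189 tt (paired-at-open v∈S N os))
    present-few {v} v∈S le | a ∷ b ∷ [] | N | _ with closed-or-all-open v (a ∷ b ∷ [])
    ...   | inj₁ (u , u∈ , c) = rare-mono tt (present-bound v∈S N (no-isolated v∈S N u∈ c) (rare-weight 3 2 502378 tt (paired-at v∈S N)))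
    ...   | inj₂ os = rare-mono tt (present-bound v∈S N (rare-weight 3 1 251189 tt (isolated-at v∈S N)) (rare-weight 4 2 316980 tt (paired-at-open v∈S N os)))
    present-few {v} v∈S le | _ ∷ _ ∷ _ ∷ _ | _ | s≤s (s≤s ())

  -- Vertices of degree three and four

  module Cases (S : Subset n) (ih : ∀ S' → ∣ S' ∣ < ∣ S ∣ → Good S') where
    open Step S ih

    dominated-closed : ∀ {v L} → v ∈ S → Nbrs S v L → (∀ {u} → u ∈ₗ L → Closed S v u) →
      All (_∈ S) (v ∷ L) × ClosedUnder S (v ∷ L) × (∀ {u} → u ∈ₗ v ∷ L → u ≢ v → v ~ u)
    dominated-closed {v} {L} v∈S N c = (v∈S ∷ All.tabulate (proj₁ ∘ sound N)) , clo , dom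
      where
      clo : ClosedUnder S (v ∷ L)
      clo (here refl) w∈S v~w = there (complete N w∈S v~w)
      clo (there u∈) w∈S u~w with c u∈ w∈S u~w
      ... | inj₁ refl = here refl
      ... | inj₂ v~w  = there (complete N w∈S v~w)
      dom : ∀ {u} → u ∈ₗ v ∷ L → u ≢ v → v ~ u
      dom (here refl) v≢v = ⊥-elim (v≢v refl)
      dom (there u∈)  _   = proj₂ (sound N u∈)

    cherry-bound : ∀ {v L} → v ∈ S → Nbrs S v L → (∀ {u} → u ∈ₗ L → Closed S v u) →
      Rare 630958 (MaxIn S) ⊎ NoCherry (v ∷ L)
    cherry-bound {v} {L} v∈S N c with cherry? (v ∷ L) | dominated-closed v∈S N c
    ... | inj₁ nc | _ = inj₂ nc
    ... | inj₂ (x , y , z , x∈ , y∈ , z∈ , x≢y , x≢z , y≢z , x≁y , x≁z) | K⊆S , clo , dom =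
      inj₁ (Bounded-⊆ (λ M → M , cherry-absent M K⊆S clo (here refl) dom x∈ y∈ z∈ x≢y x≢z y≢z x≁y x≁z) (absent-at v∈S))

    component-weighted : ∀ {K x y} k → length K ≡ suc k → Unique K → All (_∈ S) K → ClosedUnder S K → NoCherry K →
      x ∈ₗ K → y ∈ₗ K → x ≢ y → Weighted (suc k) (length (pairs K)) (MaxIn S)
    component-weighted {K} k e uK K⊆S clo nc x∈ y∈ x≢y = component-bounded {{m^n≢0 10 (suc k)}} uK K⊆S clo nc x∈ y∈ x≢y
      (residual-weighted k (subst (λ z → z + ∣ S ∖ K ∣ ≤ ∣ S ∣) e (∖-drop K uK K⊆S)))

    -- Here `d` is the number of pairs in K = N[v]. The weight is 3 · 0.251189 for three vertices
    -- and 6 · 0.158490 for four; for five it would be exactly 1.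
    dominated-component : ∀ {v u L} → v ∈ S → Nbrs S v (u ∷ L) → (∀ {u'} → u' ∈ₗ u ∷ L → Closed S v u') →
      ∀ d k p → length (pairs (v ∷ u ∷ L)) ≡ d → length (u ∷ L) ≡ k →
      T (d ^ 5 * scale ≤ᵇ p ^ 5 * 10 ^ suc k) → T (p ≤ᵇ 999999) → Rare 999999 (MaxIn S)
    dominated-component {v} {u} {L} v∈S N c d k p d≡ k≡ h p≤ with cherry-bound v∈S N c | dominated-closed v∈S N c
    ... | inj₁ b  | _ = rare-mono tt b
    ... | inj₂ nc | K⊆S , clo , _ = rare-mono p≤ (rare-weight (suc k) d p h
      (subst (λ z → Weighted (suc k) z (MaxIn S)) d≡
        (component-weighted k (cong suc k≡) (v∷L-unique v∈S N) K⊆S clo nc (here refl) (there (here refl))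
          (~-irrefl (proj₂ (sound N (here refl)))))))

    Nbrs-↭ : ∀ {v L L'} → L ↭ L' → Nbrs S v L → Nbrs S v L'
    Nbrs-↭ p N = record
      { unique   = PermutationSetoid.Unique-resp-↭ (≡.setoid _) (↭⇒↭ₛ p) (unique N)
      ; sound    = sound N ∘ ∈-resp-↭ (↭-sym p)
      ; complete = λ w∈ v~w → ∈-resp-↭ p (complete N w∈ v~w) }

    all-closed-or-open : ∀ v L → (∀ {u} → u ∈ₗ L → Closed S v u) ⊎ (∃ λ u → ∃ λ L' → L ↭ u ∷ L' × HasOuter S v u)
    all-closed-or-open v [] = inj₁ λ ()
    all-closed-or-open v (u ∷ L) with closed-or-open S v u | all-closed-or-open v L
    ... | inj₂ o | _ = inj₂ (u , L , ↭-refl , o)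
    ... | inj₁ c | inj₂ (u' , L' , p , o) = inj₂ (u' , u ∷ L' , ↭-trans (prep u p) (swap u u' ↭-refl) , o)
    ... | inj₁ c | inj₁ cs = inj₁ λ { (here refl) {w} → c {w} ; (there u∈) {w} → cs u∈ {w} }

    Paired-uncons : ∀ {v u L F} → Paired S v (u ∷ L) F → Both S v u F ⊎ Paired S v L F
    Paired-uncons (here b)  = inj₁ b
    Paired-uncons (there p) = inj₂ p

    some-paired : ∀ {v L} L' → v ∈ S → Nbrs S v L → (∀ {u} → u ∈ₗ L' → u ∈ₗ L) →
      Weighted (suc (length L)) (length L') (Paired S v L')
    some-paired {L = L} L' v∈S N sub = Bounded-Any {{m^n≢0 10 (suc (length L))}} L' λ u u∈ → both-at v∈S N (sub u∈)

    some-paired-open : ∀ {v L} L' → v ∈ S → Nbrs S v L → (∀ {u} → u ∈ₗ L' → u ∈ₗ L × HasOuter S v u) →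
      Weighted (2 + length L) (length L') (Paired S v L')
    some-paired-open {L = L} L' v∈S N sub = Bounded-Any {{m^n≢0 10 (2 + length L)}} L'
      λ u u∈ → both-at-open v∈S N (proj₁ (sub u∈)) (proj₂ (sub u∈))

    -- Four closed neighbours would give 0.630958 + 4 · 0.1 > 1. The outer vertex at `a` lowers one
    -- share to 0.063096, which suffices if another neighbour is closed (0.994054); if none is, all
    -- four shares are lowered and the isolated term is affordable (0.983342).
    degree-four : ∀ {v a b c d} → v ∈ S → Nbrs S v (a ∷ b ∷ c ∷ d ∷ []) → HasOuter S v a → Rare 999999 (MaxIn S)
    degree-four {v} {a} {b} {c} {d} v∈S N o with closed-or-all-open v (b ∷ c ∷ d ∷ [])
    ... | inj₁ (u , u∈ , cl) = rare-mono tt (total (absent-at v∈S) (present-bound v∈S N (no-isolated v∈S N (there u∈) cl)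
      (Bounded-⊆ Paired-uncons (rare-weight 6 1 63096 tt (both-at-open v∈S N (here refl) o) ∪ᴿ
        rare-weight 5 3 300000 tt (some-paired (b ∷ c ∷ d ∷ []) v∈S N there)))))
    ... | inj₂ os = rare-mono tt (total (absent-at v∈S) (present-bound v∈S N (rare-weight 5 1 100000 tt (isolated-at v∈S N))
      (rare-weight 6 4 252384 tt (paired-at-open v∈S N (o ∷ os)))))

    -- The constant is 0.900486 · 10^(-1/5), rounded up: the leaf gives G[S - v] the factor 0.900486
    -- where the induction hypothesis alone gives 1.
    absent-with-leaf : ∀ {v u o} → MaxDeg 3 S → v ∈ S → Leaf (S ∖ (v ∷ [])) u o → Rare 568170 (λ F → MaxIn S F × v ∉ F)
    absent-with-leaf {v} Δ v∈S leaf = absent-bound 568170 v∈S tt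
      (Step.leaf-bound (S ∖ (v ∷ [])) (λ S' lt → ih S' (<-trans lt smaller)) (MaxDeg-⊆ (∖⊆ S _) Δ) leaf)
      where
      smaller : ∣ S ∖ (v ∷ []) ∣ < ∣ S ∣
      smaller = ∖-drop (v ∷ []) ([] ∷ []) (v∈S ∷ [])

    -- If v is isolated in F and its neighbour u has a single neighbour o outside N[v], then o ∈ F, as u cannot be added.
    isolated-forced : ∀ {v a b c u o} → MaxDeg 3 S → v ∈ S → Nbrs S v (a ∷ b ∷ c ∷ []) → u ∈ₗ (a ∷ b ∷ c ∷ []) →
      IsOuter S v u o → (∀ {w} → IsOuter S v u w → w ≡ o) → Rare 102908 (Isolated S v)
    isolated-forced {v} {a} {b} {c} {u} {o} Δ v∈S N u∈ (o∈S , u~o , o≢v , v≁o) only =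
      MaxIn-remove (v ∷ []) (λ I@(M , v∈F , _) → M , v∈F ∷ [] , isolated-residual I , ∈-∖⁺ (forced I) λ { (here e) → o≢v e })
        -- Removing N[v] costs four vertices, and 0.102908 is 0.649297 · 10^(-4/5), rounded up.
        -- Without the forced vertex the weight would be 0.158490.
        (rare-shift S' {649297} 4 102908 tt drop (Step.present-few S' (λ S″ lt → ih S″ (<-trans lt smaller)) o∈S' small-degree))
      where
      S' = S ∖N (v ∷ [])
      forced : ∀ {F} → Isolated S v F → o ∈ F
      forced {F} I@(M , _) with o ∈? F
      ... | yes o∈F = o∈F
      ... | no o∉F = ⊥-elim (isolated-nbr I (proj₁ (sound N u∈)) (proj₂ (sound N u∈)) near)
        where
        near : ∀ {w} → w ∈ F → u ~ w → w ≡ v ⊎ v ~ w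
        near {w} w∈F u~w with w ≟ v | v ~? w
        ... | yes e  | _       = inj₁ e
        ... | no _   | yes v~w = inj₂ v~w
        ... | no w≢v | no v≁w  = ⊥-elim (o∉F (subst (_∈ F) (only (⊆S M w∈F , u~w , w≢v , v≁w)) w∈F))
      drop : 4 + ∣ S' ∣ ≤ ∣ S ∣
      drop = ∖N-drop (v ∷ []) (v ∷ a ∷ b ∷ c ∷ []) (v∷L-unique v∈S N) (v∈S ∷ All.tabulate (proj₁ ∘ sound N))
        (here (inj₁ refl) ∷ All.tabulate (λ w∈ → here (inj₂ (proj₂ (sound N w∈)))))
      smaller : ∣ S' ∣ < ∣ S ∣
      smaller = ≤-trans (s≤s (m≤n+m ∣ S' ∣ 3)) drop
      o∈S' : o ∈ S'
      o∈S' = ∈-∖N⁺ o∈S λ { (here refl) → (o≢v ∘ ≡.sym) , v≁o }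
      N' = nbrs-Nbrs S' o
      -- The neighbour `u` of `o` disappears with N[v], so at most two of the at most three
      -- neighbours remain.
      small-degree : length (nbrs S' o) ≤ 2
      small-degree = s≤s⁻¹ (Δ (u ∷ nbrs S' o) o∈S
        (All.tabulate (λ { w∈ refl → proj₂ (∖N-separated (here refl) (proj₁ (sound N' w∈))) (proj₂ (sound N u∈)) }) ∷ unique N')
        ((proj₁ (sound N u∈) , ~-sym u~o) ∷ All.tabulate λ w∈ → ∖N⊆ (proj₁ (sound N' w∈)) , proj₂ (sound N' w∈)))

    -- Minimum degree 2 in the form in which it is used: from `v` there is always a way on that
    -- avoids a given vertex `o`.
    MinDeg2 : Set
    MinDeg2 = ∀ {v} → v ∈ S → ∀ o → ∃ λ s → s ∈ S × v ~ s × s ≢ o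

    -- a and b must be adjacent to something else than v, and c cannot be adjacent to both.
    one-open : ∀ {v a b c} → MaxDeg 3 S → MinDeg2 → v ∈ S → Nbrs S v (c ∷ a ∷ b ∷ []) → HasOuter S v c →
      Closed S v a → Closed S v b → Rare 999999 (MaxIn S)
    one-open {v} {a} {b} {c} Δ δ v∈S N o@(w , w∈S , c~w , w≢v , v≁w) ca cb =
      -- The sum is 0.568170 + 0.100000 + 0.316980; with 0.630958 as its first term it would exceed
      -- 1.
      rare-mono tt (total absent (present-bound v∈S N (no-isolated v∈S N (there (here refl)) λ {w} → ca {w})
        (Bounded-⊆ Paired-uncons (rare-weight 5 1 100000 tt (both-at-open v∈S N (here refl) o) ∪ᴿ
          rare-weight 4 2 316980 tt (some-paired (a ∷ b ∷ []) v∈S N there)))))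
      where
      c∈ = sound N (here refl)
      a∈ = sound N (there (here refl))
      b∈ = sound N (there (there (here refl)))
      remains : ∀ {x} → x ∈ S × v ~ x → x ∈ S ∖ (v ∷ [])
      remains (x∈S , v~x) = ∈-∖⁺ x∈S λ { (here refl) → ~-irrefl v~x refl }
      leaf : ∀ {x y} → Closed S v x → x ∈ S × v ~ x → y ∈ S × v ~ y → ¬ x ~ c →
        (∀ {z} → v ~ z → z ∈ S → z ≡ c ⊎ z ≡ x ⊎ z ≡ y) → Leaf (S ∖ (v ∷ [])) x y
      leaf {x} {y} cx x∈ y∈ x≁c list = remains x∈ , remains y∈ , x~y , λ z∈ x~z → only (∖⊆ S _ z∈) x~z (λ { refl → proj₂ (∈-∖⁻ S _ z∈) (here refl) })
        where
        only : ∀ {z} → z ∈ S → x ~ z → z ≢ v → z ≡ y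
        only z∈S x~z z≢v with cx z∈S x~z
        ... | inj₁ z≡v = ⊥-elim (z≢v z≡v)
        ... | inj₂ v~z with list v~z z∈S
        ...   | inj₁ refl        = ⊥-elim (x≁c x~z)
        ...   | inj₂ (inj₁ refl) = ⊥-elim (~-irrefl x~z refl)
        ...   | inj₂ (inj₂ e)    = e
        x~y : x ~ y
        x~y with s , s∈S , x~s , s≢v ← δ (proj₁ x∈) v = subst (x ~_) (only s∈S x~s s≢v) x~s
      absent : Rare 568170 (λ F → MaxIn S F × v ∉ F)
      absent with a ~? c | b ~? c
      ... | no a≁c | _ = absent-with-leaf Δ v∈S (leaf (λ {w} → ca {w}) a∈ b∈ a≁c list)
        where
        list : ∀ {z} → v ~ z → z ∈ S → z ≡ c ⊎ z ≡ a ⊎ z ≡ b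
        list v~z z∈ with complete N z∈ v~z
        ... | here e                 = inj₁ e
        ... | there (here e)         = inj₂ (inj₁ e)
        ... | there (there (here e)) = inj₂ (inj₂ e)
      ... | yes _ | no b≁c = absent-with-leaf Δ v∈S (leaf (λ {w} → cb {w}) b∈ a∈ b≁c list)
        where
        list : ∀ {z} → v ~ z → z ∈ S → z ≡ c ⊎ z ≡ b ⊎ z ≡ a
        list v~z z∈ with complete N z∈ v~z
        ... | here e                 = inj₁ e
        ... | there (here e)         = inj₂ (inj₂ e)
        ... | there (there (here e)) = inj₂ (inj₁ e)
      -- Here `v`, `a`, `b` and the outer vertex `w` would be four neighbours of `c`.
      ... | yes a~c | yes b~c with unique N
      ...   | (c≢a ∷ c≢b ∷ []) ∷ (a≢b ∷ []) ∷ _ with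
        Δ (v ∷ a ∷ b ∷ w ∷ []) (proj₁ c∈)
          ((~-irrefl (proj₂ a∈) ∷ ~-irrefl (proj₂ b∈) ∷ (w≢v ∘ ≡.sym) ∷ []) ∷ (a≢b ∷ (λ { refl → v≁w (proj₂ a∈) }) ∷ []) ∷ ((λ { refl → v≁w (proj₂ b∈) }) ∷ []) ∷ [] ∷ [])
          ((v∈S , ~-sym (proj₂ c∈)) ∷ (proj₁ a∈ , ~-sym a~c) ∷ (proj₁ b∈ , ~-sym b~c) ∷ (w∈S , c~w) ∷ [])
      ...     | s≤s (s≤s (s≤s ()))

    -- The closed neighbour removes the isolated term, and 0.630958 + 0.158490 + 2 · 0.1 is below 1
    -- without further help.
    two-open : ∀ {v a b c} → v ∈ S → Nbrs S v (c ∷ a ∷ b ∷ []) → Closed S v c → HasOuter S v a → HasOuter S v b → Rare 999999 (MaxIn S)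
    two-open {a = a} {b} v∈S N cl oa ob =
      rare-mono tt (total (absent-at v∈S) (present-bound v∈S N (no-isolated v∈S N (here refl) λ {w} → cl {w})
        (Bounded-⊆ Paired-uncons (rare-weight 4 1 158490 tt (both-at v∈S N (here refl)) ∪ᴿ
          rare-weight 5 2 200000 tt (some-paired-open (a ∷ b ∷ []) v∈S N
            λ { (here refl) → there (here refl) , oa ; (there (here refl)) → there (there (here refl)) , ob })))))

    Unique-outer : Fin n → Fin n → Set
    Unique-outer v u = ∃ λ w → IsOuter S v u w × (∀ {w'} → IsOuter S v u w' → w' ≡ w)

    Two-outers : Fin n → Fin n → Set
    Two-outers v u = ∃ λ w → ∃ λ w' → w ≢ w' × IsOuter S v u w × IsOuter S v u w'

    -- Two outer vertices at each neighbour bring every pair down to 0.063096, which leaves room for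
    -- the full isolated term 0.158490.
    many-many-many : ∀ {v a b c} → v ∈ S → Nbrs S v (a ∷ b ∷ c ∷ []) →
      Two-outers v a → Two-outers v b → Two-outers v c → Rare 999999 (MaxIn S)
    many-many-many {v} {a} {b} {c} v∈S N ma mb mc = rare-mono tt (total (absent-at v∈S)
      (present-bound v∈S N (rare-weight 4 1 158490 tt (isolated-at v∈S N))
        (rare-weight 6 3 189288 tt (Bounded-Any {{m^n≢0 10 6}} (a ∷ b ∷ c ∷ []) λ
          { _ p@(here refl) → use p ma ; _ p@(there (here refl)) → use p mb ; _ p@(there (there (here refl))) → use p mc }))))
      where
      use : ∀ {u} → u ∈ₗ (a ∷ b ∷ c ∷ []) → Two-outers v u → Weighted 6 1 (Both S v u)
      use u∈ (w , w' , w≢w' , o , o') = both-at-many v∈S N u∈ w≢w' o o'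

    -- The tightest of all the sums: 0.630958 + 0.102908 + 0.063096 + 0.200000 = 0.996962. The outer
    -- vertex forced by `a` is what makes the isolated term small enough.
    one-many-open : ∀ {v a b c} → MaxDeg 3 S → v ∈ S → Nbrs S v (b ∷ a ∷ c ∷ []) →
      Unique-outer v a → Two-outers v b → HasOuter S v c → Rare 999999 (MaxIn S)
    one-many-open {v} {a} {b} {c} Δ v∈S N (o , oo , only) (w , w' , w≢w' , ow , ow') oc = rare-mono tt (total (absent-at v∈S)
      (present-bound v∈S N (isolated-forced Δ v∈S N (there (here refl)) oo only)
        (Bounded-⊆ Paired-uncons (rare-weight 6 1 63096 tt (both-at-many v∈S N (here refl) w≢w' ow ow') ∪ᴿ
          rare-weight 5 2 200000 tt (some-paired-open (a ∷ c ∷ []) v∈S N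
            λ { (here refl) → there (here refl) , (o , oo) ; (there (here refl)) → there (there (here refl)) , oc })))))

    -- Both savings are required: with pairs of total weight 0.3, neither the leaf (0.568170) nor
    -- the forced vertex (0.102908) brings the sum below 1 by itself.
    one-one-one : ∀ {v a b c} → MaxDeg 3 S → v ∈ S → Nbrs S v (a ∷ b ∷ c ∷ []) →
      Unique-outer v a → Unique-outer v b → Unique-outer v c → Rare 999999 (MaxIn S)
    one-one-one {v} {a} {b} {c} Δ v∈S N ua@(o , oo , only) ub uc = rare-mono tt (total absent
      (present-bound v∈S N (isolated-forced Δ v∈S N (here refl) oo only)
        (rare-weight 5 3 300000 tt (paired-at-open v∈S N ((_ , proj₁ (proj₂ ua)) ∷ (_ , proj₁ (proj₂ ub)) ∷ (_ , proj₁ (proj₂ uc)) ∷ [])))))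
      where
      leaf : ∀ {x y z} → (x ∷ y ∷ z ∷ []) ↭ (a ∷ b ∷ c ∷ []) → Unique-outer v x → ¬ x ~ y → ¬ x ~ z →
        ∃ λ w → Leaf (S ∖ (v ∷ [])) x w
      leaf {x} {y} {z} p (w , (w∈S , x~w , w≢v , v≁w) , only) x≁y x≁z = w , ∈-∖⁺ (proj₁ x∈) (λ { (here refl) → ~-irrefl (proj₂ x∈) refl })
          , ∈-∖⁺ w∈S (λ { (here e) → w≢v e }) , x~w , alone
        where
        N' = Nbrs-↭ (↭-sym p) N
        x∈ = sound N' (here refl)
        alone : ∀ {u} → u ∈ S ∖ (v ∷ []) → x ~ u → u ≡ w
        alone {u} u∈ x~u with v ~? u
        ... | no v≁u = only (∖⊆ S _ u∈ , x~u , (λ e → proj₂ (∈-∖⁻ S _ u∈) (here e)) , v≁u)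
        ... | yes v~u with complete N' (∖⊆ S _ u∈) v~u
        ...   | here refl                 = ⊥-elim (~-irrefl x~u refl)
        ...   | there (here refl)         = ⊥-elim (x≁y x~u)
        ...   | there (there (here refl)) = ⊥-elim (x≁z x~u)
      not-both : ∀ {x y z} → (x ∷ y ∷ z ∷ []) ↭ (a ∷ b ∷ c ∷ []) → Unique-outer v x → x ~ y → x ~ z → ⊥
      not-both {x} {y} {z} p (w , (w∈S , x~w , w≢v , v≁w) , _) x~y x~z with Nbrs-↭ (↭-sym p) N
      ... | N' with unique N' | sound N' (here refl) | sound N' (there (here refl)) | sound N' (there (there (here refl)))
      ... | (_ ∷ (y≢z ∷ []) ∷ _) | x∈ | y∈ | z∈ with
        Δ (v ∷ y ∷ z ∷ w ∷ []) (proj₁ x∈)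
          ((~-irrefl (proj₂ y∈) ∷ ~-irrefl (proj₂ z∈) ∷ (w≢v ∘ ≡.sym) ∷ []) ∷ (y≢z ∷ (λ { refl → v≁w (proj₂ y∈) }) ∷ []) ∷ ((λ { refl → v≁w (proj₂ z∈) }) ∷ []) ∷ [] ∷ [])
          ((v∈S , ~-sym (proj₂ x∈)) ∷ (proj₁ y∈ , x~y) ∷ (proj₁ z∈ , x~z) ∷ (w∈S , x~w) ∷ [])
      ...     | s≤s (s≤s (s≤s ()))
      bac : (b ∷ a ∷ c ∷ []) ↭ (a ∷ b ∷ c ∷ [])
      bac = swap b a ↭-refl
      cab : (c ∷ a ∷ b ∷ []) ↭ (a ∷ b ∷ c ∷ [])
      cab = ↭-trans (swap c a ↭-refl) (prep a (swap c b ↭-refl))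
      -- A neighbour of `v` adjacent to both others would have degree 4. So `a`, `b`, `c` span at
      -- most one edge, and one of them adjacent to neither other keeps only its outer vertex in
      -- G[S - v].
      absent : Rare 568170 (λ F → MaxIn S F × v ∉ F)
      absent with a ~? b | a ~? c | b ~? c
      ... | no a≁b  | no a≁c  | _       = absent-with-leaf Δ v∈S (proj₂ (leaf ↭-refl ua a≁b a≁c))
      ... | no a≁b  | yes _   | no b≁c  = absent-with-leaf Δ v∈S (proj₂ (leaf bac ub (a≁b ∘ ~-sym) b≁c))
      ... | no _    | yes a~c | yes b~c = ⊥-elim (not-both cab uc (~-sym a~c) (~-sym b~c))
      ... | yes _   | no a≁c  | no b≁c  = absent-with-leaf Δ v∈S (proj₂ (leaf cab uc (a≁c ∘ ~-sym) (b≁c ∘ ~-sym)))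
      ... | yes a~b | yes a~c | _       = ⊥-elim (not-both ↭-refl ua a~b a~c)
      ... | yes a~b | no _    | yes b~c = ⊥-elim (not-both bac ub (~-sym a~b) b~c)

    one-or-many : ∀ {v u} → HasOuter S v u → Unique-outer v u ⊎ Two-outers v u
    one-or-many {v} {u} (x , x∈S , u~x , x≢v , v≁x) with outer? S v u
    ... | none c              = ⊥-elim ([ x≢v , v≁x ]′ (c x∈S u~x))
    ... | one w o only        = inj₁ (w , o , only)
    ... | many w w' w≢w' o o' = inj₂ (w , w' , w≢w' , o , o')

    degree-three : ∀ {v a b c} → MaxDeg 3 S → MinDeg2 → v ∈ S → Nbrs S v (a ∷ b ∷ c ∷ []) → Rare 999999 (MaxIn S)
    degree-three {v} {a} {b} {c} Δ δ v∈S N with closed-or-open S v a | closed-or-open S v b | closed-or-open S v c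
    ... | inj₁ ca | inj₁ cb | inj₁ cc = dominated-component v∈S N
      (λ { (here refl) {w} → ca {w} ; (there (here refl)) {w} → cb {w} ; (there (there (here refl))) {w} → cc {w} }) 6 3 950940 refl refl tt tt
    ... | inj₂ oa | inj₁ cb | inj₁ cc = one-open Δ δ v∈S N oa cb cc
    ... | inj₁ ca | inj₂ ob | inj₁ cc = one-open Δ δ v∈S (Nbrs-↭ (swap a b ↭-refl) N) ob ca cc
    ... | inj₁ ca | inj₁ cb | inj₂ oc = one-open Δ δ v∈S (Nbrs-↭ (↭-trans (prep a (swap b c ↭-refl)) (swap a c ↭-refl)) N) oc ca cb
    ... | inj₁ ca | inj₂ ob | inj₂ oc = two-open v∈S N ca ob oc
    ... | inj₂ oa | inj₁ cb | inj₂ oc = two-open v∈S (Nbrs-↭ (swap a b ↭-refl) N) cb oa oc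
    ... | inj₂ oa | inj₂ ob | inj₁ cc = two-open v∈S (Nbrs-↭ (↭-trans (prep a (swap b c ↭-refl)) (swap a c ↭-refl)) N) cc oa ob
    ... | inj₂ oa | inj₂ ob | inj₂ oc with one-or-many oa | one-or-many ob | one-or-many oc
    ...   | inj₁ ua | inj₂ mb | _       = one-many-open Δ v∈S (Nbrs-↭ (swap a b ↭-refl) N) ua mb oc
    ...   | inj₂ ma | inj₁ ub | _       = one-many-open Δ v∈S N ub ma oc
    ...   | inj₁ ua | inj₁ ub | inj₂ mc = one-many-open Δ v∈S (Nbrs-↭ (↭-trans (prep a (swap b c ↭-refl)) (swap a c ↭-refl)) N) ua mc ob
    ...   | inj₂ ma | inj₂ mb | inj₁ uc = one-many-open Δ v∈S (Nbrs-↭ (prep a (swap b c ↭-refl)) N) uc ma ob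
    ...   | inj₁ ua | inj₁ ub | inj₁ uc = one-one-one Δ v∈S N ua ub uc
    ...   | inj₂ ma | inj₂ mb | inj₂ mc = many-many-many v∈S N ma mb mc

-- Graphs with all degrees two: cycles

module Cycles {n : ℕ} (G : Graph n) (S : Subset n) (ih : ∀ S' → ∣ S' ∣ < ∣ S ∣ → Dissociation.Good G S') where
  open Dissociation G
  open Step G S ih
  open Cases G S ih

  only-two : ∀ {x y z w} → MaxDeg 2 S → x ∈ S → y ∈ S → x ~ y → z ∈ S → x ~ z → y ≢ z → w ∈ S → x ~ w → w ≡ y ⊎ w ≡ z
  only-two {x} {y} {z} {w} Δ x∈ y∈ x~y z∈ x~z y≢z w∈ x~w with w ≟ y | w ≟ z
  ... | yes e  | _      = inj₁ e
  ... | no _   | yes e  = inj₂ e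
  ... | no w≢y | no w≢z with Δ (w ∷ y ∷ z ∷ []) x∈ ((w≢y ∷ w≢z ∷ []) ∷ (y≢z ∷ []) ∷ [] ∷ [])
                             ((w∈ , x~w) ∷ (y∈ , x~y) ∷ (z∈ , x~z) ∷ [])
  ...   | s≤s (s≤s ())

  -- The second neighbour of the closed `o` can only be `p`; then `u` and `o` exhaust the neighbours
  -- of `p`.
  not-mixed : ∀ {u o p} → MaxDeg 2 S → MinDeg2 → u ∈ S → Nbrs S u (o ∷ p ∷ []) → Closed S u o → HasOuter S u p → ⊥
  not-mixed {u} {o} {p} Δ δ u∈S N c (w , w∈S , p~w , w≢u , u≁w)
    with o∈S , u~o ← sound N (here refl) | p∈S , u~p ← sound N (there (here refl))
    with only-two Δ p∈S u∈S (~-sym u~p) o∈S p~o (~-irrefl u~o) w∈S p~w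
    where
    p~o : p ~ o
    p~o with s , s∈S , o~s , s≢u ← δ o∈S u with c s∈S o~s
    ... | inj₁ s≡u = ⊥-elim (s≢u s≡u)
    ... | inj₂ u~s with complete N s∈S u~s
    ...   | here refl         = ⊥-elim (~-irrefl o~s refl)
    ...   | there (here refl) = ~-sym o~s
  ... | inj₁ w≡u  = w≢u w≡u
  ... | inj₂ refl = u≁w u~o

  -- The complement of a 4-cycle consists of two disjoint edges, so its six pairs are counted as in
  -- a complete graph on four vertices.
  four-cycle : ∀ {u o p q} → MaxDeg 2 S → u ∈ S → Nbrs S u (o ∷ p ∷ []) → IsOuter S u o q → IsOuter S u p q →
    Rare 999999 (MaxIn S)
  four-cycle {u} {o} {p} {q} Δ u∈S N (q∈S , o~q , q≢u , u≁q) (_ , p~q , _ , _)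
    with o∈S , u~o ← sound N (here refl) | p∈S , u~p ← sound N (there (here refl)) | (o≢p ∷ []) ∷ _ ← unique N
    = rare-mono tt (rare-weight 4 6 950940 tt (component-weighted {K = u ∷ o ∷ p ∷ q ∷ []} 3 refl
        ((~-irrefl u~o ∷ ~-irrefl u~p ∷ (q≢u ∘ ≡.sym) ∷ []) ∷ (o≢p ∷ ~-irrefl o~q ∷ []) ∷ (~-irrefl p~q ∷ []) ∷ [] ∷ [])
        (u∈S ∷ o∈S ∷ p∈S ∷ q∈S ∷ []) clo nc (here refl) (there (here refl)) (~-irrefl u~o)))
    where
    K = u ∷ o ∷ p ∷ q ∷ []
    clo : ClosedUnder S K
    clo (here refl) w∈ u~w with complete N w∈ u~w
    ... | here e         = there (here e)
    ... | there (here e) = there (there (here e))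
    clo (there (here refl)) w∈ o~w with only-two Δ o∈S u∈S (~-sym u~o) q∈S o~q (q≢u ∘ ≡.sym) w∈ o~w
    ... | inj₁ e = here e
    ... | inj₂ e = there (there (there (here e)))
    clo (there (there (here refl))) w∈ p~w with only-two Δ p∈S u∈S (~-sym u~p) q∈S p~q (q≢u ∘ ≡.sym) w∈ p~w
    ... | inj₁ e = here e
    ... | inj₂ e = there (there (there (here e)))
    clo (there (there (there (here refl)))) w∈ q~w with only-two Δ q∈S o∈S (~-sym o~q) p∈S (~-sym p~q) o≢p w∈ q~w
    ... | inj₁ e = there (here e)
    ... | inj₂ e = there (there (here e))
    opposite : ∀ {x} → x ∈ₗ K → ∃ λ x' → ∀ {y} → y ∈ₗ K → x ≢ y → x ~ y ⊎ y ≡ x'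
    opposite (here refl) = q , λ
      { (here refl) x≢x → ⊥-elim (x≢x refl) ; (there (here refl)) _ → inj₁ u~o
      ; (there (there (here refl))) _ → inj₁ u~p ; (there (there (there (here e)))) _ → inj₂ e }
    opposite (there (here refl)) = p , λ
      { (here refl) _ → inj₁ (~-sym u~o) ; (there (here refl)) x≢x → ⊥-elim (x≢x refl)
      ; (there (there (here e))) _ → inj₂ e ; (there (there (there (here refl)))) _ → inj₁ o~q }
    opposite (there (there (here refl))) = o , λ
      { (here refl) _ → inj₁ (~-sym u~p) ; (there (here e)) _ → inj₂ e
      ; (there (there (here refl))) x≢x → ⊥-elim (x≢x refl) ; (there (there (there (here refl)))) _ → inj₁ p~q }
    opposite (there (there (there (here refl)))) = u , λ
      { (here e) _ → inj₂ e ; (there (here refl)) _ → inj₁ (~-sym o~q)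
      ; (there (there (here refl))) _ → inj₁ (~-sym p~q) ; (there (there (there (here refl)))) x≢x → ⊥-elim (x≢x refl) }
    nc : NoCherry K
    nc x∈ y∈ z∈ x≢y x≢z y≢z with opposite x∈
    ... | x' , h with h y∈ x≢y | h z∈ x≢z
    ... | inj₁ x~y | _        = inj₁ x~y
    ... | inj₂ _   | inj₁ x~z = inj₂ x~z
    ... | inj₂ e   | inj₂ e'  = ⊥-elim (y≢z (≡.trans e (≡.sym e')))

  -- Around the path q o u p r, a set F avoiding u contains the edge oq, or the edge pr, or both o and p as isolated vertices.
  long-cycle : ∀ {u o p q r} → MaxDeg 2 S → MinDeg2 → u ∈ S → Nbrs S u (o ∷ p ∷ []) → IsOuter S u o q → IsOuter S u p r →
    q ≢ r → Rare 999999 (MaxIn S)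
  long-cycle {u} {o} {p} {q} {r} Δ δ u∈S N oq@(q∈S , o~q , q≢u , u≁q) pr@(r∈S , p~r , r≢u , u≁r) q≢r
    with o∈S , u~o ← sound N (here refl) | p∈S , u~p ← sound N (there (here refl)) | (o≢p ∷ []) ∷ _ ← unique N
    -- The sets avoiding `u` weigh 2 · 0.158490 + 0.100000 = 0.416980 in place of 0.630958, which
    -- brings the sum to 0.985149.
    = rare-mono tt (Bounded-⊆ cover ((rare-weight 3 1 251189 tt (isolated-at u∈S N) ∪ᴿ
        rare-weight 4 2 316980 tt (paired-at-open u∈S N ((q , oq) ∷ (r , pr) ∷ []))) ∪ᴿ
        ((rare-weight 4 1 158490 tt (edge o∈S u~o oq) ∪ᴿ rare-weight 4 1 158490 tt (edge p∈S u~p pr)) ∪ᴿ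
          rare-weight 5 1 100000 tt separate-bound)))
    where
    edge : ∀ {o q} → o ∈ S → u ~ o → IsOuter S u o q → Weighted 4 1 (Both S o q)
    -- The fourth lost vertex `s` is the other neighbour of `q`; it is not `u`, because `u` and `q`
    -- are not adjacent.
    edge {o} {q} o∈S u~o (q∈S , o~q , q≢u , u≁q) with s , s∈S , q~s , s≢o ← δ q∈S o =
      both-weighted (u ∷ q ∷ s ∷ []) o∈S o~q
        (((~-irrefl u~o ∘ ≡.sym) ∷ ~-irrefl o~q ∷ (s≢o ∘ ≡.sym) ∷ []) ∷ ((q≢u ∘ ≡.sym) ∷ (λ { refl → u≁q (~-sym q~s) }) ∷ []) ∷ (~-irrefl q~s ∷ []) ∷ [] ∷ [])
        ((u∈S , inj₁ (~-sym u~o)) ∷ (q∈S , inj₁ o~q) ∷ (s∈S , inj₂ q~s) ∷ [])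
    Separate : Subset n → Set
    Separate F = MaxIn S F × o ∈ F × p ∈ F × u ∉ F × q ∉ F × r ∉ F
    only-o : ∀ {w} → w ∈ S → o ~ w → w ≡ u ⊎ w ≡ q
    only-o = only-two Δ o∈S u∈S (~-sym u~o) q∈S o~q (q≢u ∘ ≡.sym)
    only-p : ∀ {w} → w ∈ S → p ~ w → w ≡ u ⊎ w ≡ r
    only-p = only-two Δ p∈S u∈S (~-sym u~p) r∈S p~r (r≢u ∘ ≡.sym)
    separate-bound : Weighted 5 1 Separate
    separate-bound = MaxIn-remove (o ∷ p ∷ [])
      (λ { (M , o∈F , p∈F , u∉F , q∉F , r∉F) → M , o∈F ∷ p∈F ∷ [] ,
        residual M ((o≢p ∷ []) ∷ [] ∷ []) (o∈F ∷ p∈F ∷ []) ∖N⊆ ∖N-separated (cov M u∉F q∉F r∉F) })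
      (residual-weighted 4 (∖N-drop (o ∷ p ∷ []) (o ∷ p ∷ u ∷ q ∷ r ∷ [])
        ((o≢p ∷ (~-irrefl u~o ∘ ≡.sym) ∷ ~-irrefl o~q ∷ (λ { refl → u≁r u~o }) ∷ [])
          ∷ ((~-irrefl u~p ∘ ≡.sym) ∷ (λ { refl → u≁q u~p }) ∷ ~-irrefl p~r ∷ [])
          ∷ ((q≢u ∘ ≡.sym) ∷ (r≢u ∘ ≡.sym) ∷ []) ∷ (q≢r ∷ []) ∷ [] ∷ [])
        (o∈S ∷ p∈S ∷ u∈S ∷ q∈S ∷ r∈S ∷ [])
        (here (inj₁ refl) ∷ there (here (inj₁ refl)) ∷ here (inj₂ (~-sym u~o)) ∷ here (inj₂ o~q) ∷ there (here (inj₂ p~r)) ∷ [])))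
      where
      cov : ∀ {F} → MaxIn S F → u ∉ F → q ∉ F → r ∉ F → ∀ {x} → x ∈ F → x ∈ₗ (o ∷ p ∷ []) ⊎ x ∈ S ∖N (o ∷ p ∷ [])
      cov M u∉F q∉F r∉F {x} x∈F with x ≟ o | x ≟ p
      ... | yes e  | _      = inj₁ (here e)
      ... | no _   | yes e  = inj₁ (there (here e))
      ... | no x≢o | no x≢p = inj₂ (∈-∖N⁺ (⊆S M x∈F) λ
        { (here refl) → (x≢o ∘ ≡.sym) , λ o~x → [ (λ { refl → u∉F x∈F }) , (λ { refl → q∉F x∈F }) ]′ (only-o (⊆S M x∈F) o~x)
        ; (there (here refl)) → (x≢p ∘ ≡.sym) , λ p~x → [ (λ { refl → u∉F x∈F }) , (λ { refl → r∉F x∈F }) ]′ (only-p (⊆S M x∈F) p~x) })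
    cover : ∀ {F} → MaxIn S F → (Isolated S u F ⊎ Paired S u (o ∷ p ∷ []) F) ⊎ ((Both S o q F ⊎ Both S p r F) ⊎ Separate F)
    cover {F} M with u ∈? F | o ∈? F | p ∈? F | q ∈? F | r ∈? F
    ... | yes u∈F | _ | _ | _ | _ = inj₁ (isolated-or-paired N M u∈F)
    ... | no _ | yes o∈F | _ | yes q∈F | _ = inj₂ (inj₁ (inj₁ (M , o∈F , q∈F)))
    ... | no _ | _ | yes p∈F | _ | yes r∈F = inj₂ (inj₁ (inj₂ (M , p∈F , r∈F)))
    ... | no u∉F | yes o∈F | yes p∈F | no q∉F | no r∉F = inj₂ (inj₂ (M , o∈F , p∈F , u∉F , q∉F , r∉F))
    ... | no u∉F | no o∉F | no p∉F | _ | _ = ⊥-elim (no-augmentation M u∈S u∉F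
          (λ y∈ _ u~y _ → ⊥-elim (none' y∈ u~y)) (λ y∈ _ u~y _ → none' y∈ u~y))
      where
      none' : ∀ {y} → y ∈ F → u ~ y → ⊥
      none' y∈ u~y with complete N (⊆S M y∈) u~y
      ... | here refl         = o∉F y∈
      ... | there (here refl) = p∉F y∈
    -- Here `o` is isolated in F and is the only neighbour of `u` in F, so `u` could be added.
    ... | no u∉F | yes o∈F | no p∉F | no q∉F | _ = ⊥-elim (no-augmentation M u∈S u∉F
          (λ y∈ z∈ u~y u~z → ≡.trans (at y∈ u~y) (≡.sym (at z∈ u~z)))
          (λ y∈ z∈ u~y y~z → alone z∈ (subst (_~ _) (at y∈ u~y) y~z)))
      where
      at : ∀ {y} → y ∈ F → u ~ y → y ≡ o
      at y∈ u~y with complete N (⊆S M y∈) u~y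
      ... | here e            = e
      ... | there (here refl) = ⊥-elim (p∉F y∈)
      alone : ∀ {z} → z ∈ F → ¬ o ~ z
      alone z∈ o~z = [ (λ { refl → u∉F z∈ }) , (λ { refl → q∉F z∈ }) ]′ (only-o (⊆S M z∈) o~z)
    ... | no u∉F | no o∉F | yes p∈F | _ | no r∉F = ⊥-elim (no-augmentation M u∈S u∉F
          (λ y∈ z∈ u~y u~z → ≡.trans (at y∈ u~y) (≡.sym (at z∈ u~z)))
          (λ y∈ z∈ u~y y~z → alone z∈ (subst (_~ _) (at y∈ u~y) y~z)))
      where
      at : ∀ {y} → y ∈ F → u ~ y → y ≡ p
      at y∈ u~y with complete N (⊆S M y∈) u~y
      ... | here refl      = ⊥-elim (o∉F y∈)
      ... | there (here e) = e
      alone : ∀ {z} → z ∈ F → ¬ p ~ z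
      alone z∈ p~z = [ (λ { refl → u∉F z∈ }) , (λ { refl → r∉F z∈ }) ]′ (only-p (⊆S M z∈) p~z)

  degree-two : ∀ {u o p} → MaxDeg 2 S → MinDeg2 → u ∈ S → Nbrs S u (o ∷ p ∷ []) → Rare 999999 (MaxIn S)
  degree-two {u} {o} {p} Δ δ u∈S N with closed-or-open S u o | closed-or-open S u p
  ... | inj₁ co | inj₁ cp = dominated-component u∈S N (λ { (here refl) {w} → co {w} ; (there (here refl)) {w} → cp {w} }) 3 2 753567 refl refl tt tt
  ... | inj₁ co | inj₂ op = ⊥-elim (not-mixed Δ δ u∈S N co op)
  ... | inj₂ oo | inj₁ cp = ⊥-elim (not-mixed Δ δ u∈S (Nbrs-↭ (swap o p ↭-refl) N) cp oo)
  ... | inj₂ (q , oq) | inj₂ (r , pr) with q ≟ r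
  ...   | yes refl = four-cycle Δ u∈S N oq pr
  ...   | no q≢r   = long-cycle Δ δ u∈S N oq pr q≢r

-- Five-vertex graphs whose complement is a matching

Joins : Fin 5 × Fin 5 → Fin 5 → Fin 5 → Set
Joins (a , b) u v = (u ≡ a × v ≡ b) ⊎ (u ≡ b × v ≡ a)

-- Its `does` computes to the Boolean test inside `edgeIn`, which is how propositions and Booleans
-- are matched below.
joins? : ∀ e u v → Dec (Joins e u v)
joins? (a , b) u v = ((u ≟ a) ×-dec (v ≟ b)) ⊎-dec ((u ≟ b) ×-dec (v ≟ a))

edgeIn-true : ∀ {M u v} → Any (λ e → Joins e u v) M → edgeIn M u v ≡ true
edgeIn-true {e ∷ M} {u} {v} (here j)  = cong (_∨ edgeIn M u v) (dec-true (joins? e u v) j)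
edgeIn-true {e ∷ M} {u} {v} (there p) =
  ≡.trans (cong (does (joins? e u v) ∨_) (edgeIn-true {M} p)) (Bool.∨-zeroʳ _)

edgeIn-joins : ∀ M {u v} → edgeIn M u v ≡ true → Any (λ e → Joins e u v) M
edgeIn-joins (e ∷ M) {u} {v} h with joins? e u v
... | yes j = here j
... | no ¬j = there (edgeIn-joins M (subst (λ b → b ∨ edgeIn M u v ≡ true) (dec-false (joins? e u v) ¬j) h))

edgeIn-false : ∀ M {u v} → ¬ Any (λ e → Joins e u v) M → edgeIn M u v ≡ false
edgeIn-false M {u} {v} ¬j with edgeIn M u v in eq
... | true  = ⊥-elim (¬j (edgeIn-joins M eq))
... | false = refl

module Complement (A : Fin 5 → Fin 5 → Bool) (A-sym : ∀ i j → A i j ≡ A j i) (A-irrefl : ∀ i → A i i ≡ false)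
  (no-cherry : ∀ {x y z} → x ≢ y → x ≢ z → y ≢ z → A x y ≡ true ⊎ A x z ≡ true) where

  Gap : Fin 5 → Fin 5 → Set
  Gap i j = i ≢ j × A i j ≡ false

  gap? : ∀ i j → Dec (Gap i j)
  gap? i j = ¬? (i ≟ j) ×-dec (A i j Bool.≟ false)

  Gap-sym : ∀ {i j} → Gap i j → Gap j i
  Gap-sym {i} {j} (i≢j , h) = i≢j ∘ ≡.sym , ≡.trans (A-sym j i) h

  Gap-unique : ∀ {i j k} → Gap i j → Gap i k → j ≡ k
  Gap-unique {i} {j} {k} (i≢j , h) (i≢k , h') with j ≟ k
  ... | yes e = e
  ... | no j≢k with no-cherry i≢j i≢k j≢k
  ...   | inj₁ t with () ← ≡.trans (≡.sym t) h
  ...   | inj₂ t with () ← ≡.trans (≡.sym t) h'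

  same-or-disjoint : ∀ {a b i j} → Gap a b → Gap i j → Joins (a , b) i j ⊎ Disjoint (a , b) (i , j)
  same-or-disjoint {a} {b} {i} {j} g h with i ≟ a | i ≟ b | j ≟ a | j ≟ b
  ... | yes refl | _ | _ | _ = inj₁ (inj₁ (refl , Gap-unique h g))
  ... | no _ | yes refl | _ | _ = inj₁ (inj₂ (refl , Gap-unique h (Gap-sym g)))
  ... | no _ | no _ | yes refl | _ = inj₁ (inj₂ (Gap-unique (Gap-sym h) g , refl))
  ... | no _ | no _ | no _ | yes refl = inj₁ (inj₁ (Gap-unique (Gap-sym h) (Gap-sym g) , refl))
  ... | no i≢a | no i≢b | no j≢a | no j≢b = inj₂ (i≢a ∘ ≡.sym , j≢a ∘ ≡.sym , i≢b ∘ ≡.sym , j≢b ∘ ≡.sym)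

  agrees : ∀ M → All (λ (a , b) → Gap a b) M → (∀ {i j} → Gap i j → Any (λ e → Joins e i j) M) →
    ∀ i j → A i j ≡ K5minus M i j
  agrees M gaps covers i j with i ≟ j
  ... | yes refl = A-irrefl i
  ... | no i≢j with A i j in eq
  ...   | false = cong not (≡.sym (edgeIn-true {M} (covers (i≢j , eq))))
  ...   | true = cong not (≡.sym (edgeIn-false M λ p → absurd (find p)))
    where
    absurd : (∃ λ e → e ∈ₗ M × Joins e i j) → ⊥
    absurd ((a , b) , e∈ , inj₁ (refl , refl)) with () ← ≡.trans (≡.sym eq) (proj₂ (All.lookup gaps e∈))
    absurd ((a , b) , e∈ , inj₂ (refl , refl)) with () ← ≡.trans (≡.sym eq) (proj₂ (Gap-sym (All.lookup gaps e∈)))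

  Complementary : Set
  Complementary = Σ Matching5 λ M → length (edges M) ≤ 2 × (∀ i j → A i j ≡ K5minus (edges M) i j)

  -- A third non-edge disjoint from two disjoint ones would need a sixth vertex.
  two-gaps-cover : ∀ {a b c d} → Gap a b → Gap c d → Disjoint (a , b) (c , d) →
    ∀ {i j} → Gap i j → Any (λ e → Joins e i j) ((a , b) ∷ (c , d) ∷ [])
  two-gaps-cover {a} {b} {c} {d} g h (a≢c , a≢d , b≢c , b≢d) {i} {j} g'
    with same-or-disjoint g g' | same-or-disjoint h g'
  ... | inj₁ p | _ = here p
  ... | inj₂ _ | inj₁ p = there (here p)
  ... | inj₂ (a≢i , a≢j , b≢i , b≢j) | inj₂ (c≢i , c≢j , d≢i , d≢j) = ⊥-elim (<⇒≱ six≤5 ≤-refl)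
    where
    six≤5 : 6 ≤ 5
    six≤5 = Unique-⊆-length {xs = a ∷ b ∷ c ∷ d ∷ i ∷ j ∷ []} {ys = allFin 5}
      ((proj₁ g ∷ a≢c ∷ a≢d ∷ a≢i ∷ a≢j ∷ []) ∷ (b≢c ∷ b≢d ∷ b≢i ∷ b≢j ∷ []) ∷ (proj₁ h ∷ c≢i ∷ c≢j ∷ [])
        ∷ (d≢i ∷ d≢j ∷ []) ∷ (proj₁ g' ∷ []) ∷ [] ∷ []) (λ _ → ∈-allFin _)

  with-gap : ∀ {a b} → Gap a b → Dec (∃ λ c → ∃ λ d → Gap c d × ¬ Joins (a , b) c d) → Complementary
  with-gap {a} {b} g (no ¬h) = record { edges = (a , b) ∷ [] ; proper = proj₁ g ∷ [] ; disjoint = [] ∷ [] } , s≤s z≤n ,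
    agrees ((a , b) ∷ []) (g ∷ []) covers
    where
    covers : ∀ {i j} → Gap i j → Any (λ e → Joins e i j) ((a , b) ∷ [])
    covers {i} {j} g' with joins? (a , b) i j
    ... | yes p = here p
    ... | no ¬p = ⊥-elim (¬h (i , j , g' , ¬p))
  with-gap {a} {b} g (yes (c , d , h , ¬joins)) with same-or-disjoint g h
  ... | inj₁ p = ⊥-elim (¬joins p)
  ... | inj₂ ab-cd = record { edges = (a , b) ∷ (c , d) ∷ [] ; proper = proj₁ g ∷ proj₁ h ∷ [] ; disjoint = (ab-cd ∷ []) ∷ [] ∷ [] } ,
    s≤s (s≤s z≤n) , agrees ((a , b) ∷ (c , d) ∷ []) (g ∷ h ∷ []) (two-gaps-cover g h ab-cd)

  complement-matching : Complementary
  complement-matching = search (Fin.any? λ a → Fin.any? (gap? a))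
    where
    search : Dec (∃ λ a → ∃ λ b → Gap a b) → Complementary
    search (no ¬g) = record { edges = [] ; proper = [] ; disjoint = [] } , z≤n , agrees [] [] λ g → ⊥-elim (¬g (_ , _ , g))
    search (yes (a , b , g)) = with-gap g (Fin.any? λ c → Fin.any? λ d → gap? c d ×-dec ¬? (joins? (a , b) c d))

-- The induction, with strictness and the equality case

lookup-injective : ∀ {A : Set} {xs : List A} → Unique xs → ∀ {i j} → lookup xs i ≡ lookup xs j → i ≡ j
lookup-injective (x∉ ∷ u) {zero}  {zero}  _ = refl
lookup-injective (x∉ ∷ u) {zero}  {suc j} e = ⊥-elim (All.lookup x∉ (∈-lookup j) e)
lookup-injective (x∉ ∷ u) {suc i} {zero}  e = ⊥-elim (All.lookup x∉ (∈-lookup i) (≡.sym e))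
lookup-injective (x∉ ∷ u) {suc i} {suc j} e = cong suc (lookup-injective u e)

-- Turns a factor b / K below 1, here the fifth power of 0.999999, into a gap of one between
-- integers.
a*K≤b*T⇒a≤T∸1 : ∀ {a b} K T .{{_ : NonZero T}} → b < K → a * K ≤ b * T → a ≤ T ∸ 1
a*K≤b*T⇒a≤T∸1 {a} {b} K T b<K le = <⇒≤pred (*-cancelʳ-< K a T (≤-<-trans le
  (subst (b * T <_) (*-comm K T) (*-monoˡ-< T b<K))))

power-step : ∀ b {m m'} .{{_ : NonZero b}} k → k + m' ≤ m → b ^ k * b ^ m' ≤ b ^ m
power-step b {m} {m'} k le = subst (_≤ b ^ m) (^-distribˡ-+-* b k m') (^-monoʳ-≤ b le)

-- The gap of one on the left is multiplied by b^k ≥ 1, so strictness survives the factor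
-- contributed by a component.
power-step-∸1 : ∀ b {m m'} .{{_ : NonZero b}} k → k + m' ≤ m → b ^ k * (b ^ m' ∸ 1) ≤ b ^ m ∸ 1
power-step-∸1 b {m} {m'} k le = begin
  b ^ k * (b ^ m' ∸ 1)       ≡⟨ *-distribˡ-∸ (b ^ k) (b ^ m') 1 ⟩
  b ^ k * b ^ m' ∸ b ^ k * 1 ≡⟨ cong (b ^ k * b ^ m' ∸_) (*-identityʳ (b ^ k)) ⟩
  b ^ k * b ^ m' ∸ b ^ k     ≤⟨ ∸-mono (power-step b k le) (m^n>0 b k) ⟩
  b ^ m ∸ 1                  ∎
  where open ≤-Reasoning

module Classification {n : ℕ} (G : Graph n) where
  open Dissociation G

  -- `IsExtremal` relative to G[S]. The bijection is an injective map `vertex` with image `S`, so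
  -- that a block can be added without reindexing `S`.
  record Extremal (S : Subset n) : Set where
    field
      k          : ℕ
      size       : ∣ S ∣ ≡ 5 * k
      matching   : Fin k → Matching5
      few-edges  : ∀ j → length (edges (matching j)) ≤ 2
      vertex     : Fin k × Fin 5 → Fin n
      injective  : ∀ {p q} → vertex p ≡ vertex q → p ≡ q
      vertex∈    : ∀ p → vertex p ∈ S
      surjective : ∀ {v} → v ∈ S → ∃ λ p → vertex p ≡ v
      adjacent   : ∀ p q → adj G (vertex p) (vertex q) ≡ unionAdj matching p q

  Strict : Subset n → Set
  Strict S = Bounded 1 (10 ^ ∣ S ∣ ∸ 1) 1 (MaxIn S)

  -- The alternative `tight` records the structure and the bound but not equality; that the
  -- structure attains the bound is shown by counting at the end.
  data Verdict (S : Subset n) : Set where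
    strict : Strict S → Verdict S
    tight  : Good S → Extremal S → Verdict S

  verdict⇒good : ∀ {S} → Verdict S → Good S
  verdict⇒good {S} (strict b) = Bounded-rescale (*-monoˡ-≤ 1 (*-monoʳ-≤ 1 (m∸n≤m (10 ^ ∣ S ∣) 1))) b
  verdict⇒good (tight b _) = b

  rare⇒strict : ∀ {S} → Few ∣ S ∣ 999999 (MaxIn S) → Strict S
  rare⇒strict {S} b = bounded λ l u h → subst₂ _≤_ (≡.sym (*-identityʳ _)) (≡.sym (*-identityˡ _))
    (a*K≤b*T⇒a≤T∸1 {length l ^ 5} {999999 ^ 5} scale (10 ^ ∣ S ∣) {{m^n≢0 10 ∣ S ∣}} (<ᵇ⇒< (999999 ^ 5) scale tt) (length-bound b l u h))

  -- The starting point of every extremal structure: zero blocks, and the empty set as the only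
  -- candidate against 10^0 = 1.
  no-vertices : ∀ {S} → (∀ {v} → v ∉ S) → Verdict S
  no-vertices {S} empty = tight (bounded good) record
    { k = 0 ; size = n≤0⇒n≡0 (subst (∣ S ∣ ≤_) (∣⊥∣≡0 n) (p⊆q⇒∣p∣≤∣q∣ {q = ∅} λ v∈ → ⊥-elim (empty v∈)))
    ; matching = λ () ; few-edges = λ () ; vertex = λ () ; injective = λ { {()} } ; vertex∈ = λ ()
    ; surjective = λ v∈ → ⊥-elim (empty v∈) ; adjacent = λ () }
    where
    good : ∀ l → Unique l → All (MaxIn S) l → length l ^ 5 * 1 ≤ 1 ^ 5 * 10 ^ ∣ S ∣
    good [] _ _ = z≤n
    good (_ ∷ []) _ _ = subst (1 ≤_) (≡.sym (*-identityˡ _)) (m^n>0 10 ∣ S ∣)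
    good (F ∷ F' ∷ _) ((F≢F' ∷ _) ∷ _) (M ∷ M' ∷ _) =
      ⊥-elim (F≢F' (⊆-antisym (λ v∈ → ⊥-elim (empty (⊆S M v∈))) (λ v∈ → ⊥-elim (empty (⊆S M' v∈)))))

  module _ {S : Subset n} {K : List (Fin n)} (|K|≡5 : length K ≡ 5) (uK : Unique K) (K⊆S : All (_∈ S) K)
    (clo : ClosedUnder S K) (nc : NoCherry K) where

    private
      κ : Fin 5 → Fin n
      κ i = lookup K (cast (≡.sym |K|≡5) i)

      κ∈ : ∀ i → κ i ∈ₗ K
      κ∈ i = ∈-lookup _

      κ-injective : ∀ {i j} → κ i ≡ κ j → i ≡ j
      κ-injective {i} {j} e = Fin.toℕ-injective (≡.trans (≡.sym (Fin.toℕ-cast _ i))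
        (≡.trans (cong toℕ (lookup-injective uK e)) (Fin.toℕ-cast _ j)))

      κ-surjective : ∀ {v} → v ∈ₗ K → ∃ λ i → κ i ≡ v
      κ-surjective {v} v∈ = cast |K|≡5 (Any.index v∈) ,
        ≡.trans (cong (lookup K) (Fin.toℕ-injective (≡.trans (Fin.toℕ-cast _ (cast |K|≡5 (Any.index v∈))) (Fin.toℕ-cast _ (Any.index v∈)))))
          (≡.sym (lookup-index v∈))

      block = Complement.complement-matching (λ i j → adj G (κ i) (κ j)) (λ i j → Graph.sym G (κ i) (κ j)) (λ i → Graph.irrefl G (κ i))
        (λ x≢y x≢z y≢z → nc (κ∈ _) (κ∈ _) (κ∈ _) (x≢y ∘ κ-injective) (x≢z ∘ κ-injective) (y≢z ∘ κ-injective))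

      separated : ∀ {x w} → x ∈ₗ K → w ∈ S ∖ K → adj G x w ≡ false
      separated {x} {w} x∈ w∈ with adj G x w in eq
      ... | false = refl
      ... | true  = ⊥-elim (proj₂ (∈-∖⁻ S K w∈) (clo x∈ (∖⊆ S K w∈) eq))

    add-block : Extremal (S ∖ K) → Extremal S
    add-block E = record
      { k = suc k ; size = size' ; matching = matching' ; few-edges = few-edges' ; vertex = vertex'
      ; injective = injective' ; vertex∈ = vertex∈' ; surjective = surjective' ; adjacent = adjacent' }
      where
      open Extremal E
      matching' : Fin (suc k) → Matching5
      matching' zero    = proj₁ block
      matching' (suc j) = matching j
      few-edges' : ∀ j → length (edges (matching' j)) ≤ 2
      few-edges' zero    = proj₁ (proj₂ block)
      few-edges' (suc j) = few-edges j
      vertex' : Fin (suc k) × Fin 5 → Fin n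
      vertex' (zero  , i) = κ i
      vertex' (suc j , i) = vertex (j , i)
      outside-K : ∀ {i p} → κ i ≢ vertex p
      outside-K {i} {p} e = proj₂ (∈-∖⁻ S K (vertex∈ p)) (subst (_∈ₗ K) e (κ∈ i))
      injective' : ∀ {p q} → vertex' p ≡ vertex' q → p ≡ q
      injective' {zero  , i} {zero  , j} e = cong (zero ,_) (κ-injective e)
      injective' {zero  , i} {suc _ , j} e = ⊥-elim (outside-K e)
      injective' {suc _ , i} {zero  , j} e = ⊥-elim (outside-K (≡.sym e))
      injective' {suc a , i} {suc b , j} e with refl ← injective e = refl
      vertex∈' : ∀ p → vertex' p ∈ S
      vertex∈' (zero  , i) = All.lookup K⊆S (κ∈ i)
      vertex∈' (suc j , i) = ∖⊆ S K (vertex∈ (j , i))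
      surjective' : ∀ {v} → v ∈ S → ∃ λ p → vertex' p ≡ v
      surjective' {v} v∈S with v ∈ₗ? K
      ... | yes v∈K with i , e ← κ-surjective v∈K = (zero , i) , e
      ... | no v∉K with (j , i) , e ← surjective (∈-∖⁺ v∈S v∉K) = (suc j , i) , e
      adjacent' : ∀ p q → adj G (vertex' p) (vertex' q) ≡ unionAdj matching' p q
      adjacent' (zero  , i) (zero  , j) = proj₂ (proj₂ block) i j
      adjacent' (zero  , i) (suc b , j) = separated (κ∈ i) (vertex∈ (b , j))
      adjacent' (suc a , i) (zero  , j) = ≡.trans (Graph.sym G _ _) (separated (κ∈ j) (vertex∈ (a , i)))
      adjacent' (suc a , i) (suc b , j) = adjacent (a , i) (b , j)
      size' : ∣ S ∣ ≡ 5 * suc k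
      size' = begin-equality
        ∣ S ∣                   ≡⟨ ≤-antisym (∣∣-cover K split-S) (∖-drop K uK K⊆S) ⟩
        length K + ∣ S ∖ K ∣    ≡⟨ cong₂ _+_ |K|≡5 size ⟩
        5 + 5 * k               ≡⟨ *-suc 5 k ⟨
        5 * suc k               ∎
        where
        open ≤-Reasoning
        split-S : ∀ {x} → x ∈ S → x ∈ S ∖ K ⊎ x ∈ₗ K
        split-S {x} x∈S with x ∈ₗ? K
        ... | yes x∈K = inj₂ x∈K
        ... | no x∉K  = inj₁ (∈-∖⁺ x∈S x∉K)

    private
      drop5 : 5 + ∣ S ∖ K ∣ ≤ ∣ S ∣
      drop5 = subst (λ z → z + ∣ S ∖ K ∣ ≤ ∣ S ∣) |K|≡5 (∖-drop K uK K⊆S)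

      κ-distinct : κ zero ≢ κ (suc zero)
      κ-distinct e with () ← κ-injective e

      ten-times : ∀ {T} → Bounded 1 T 1 (MaxIn (S ∖ K)) → Bounded 1 T (length (pairs K)) (MaxIn S)
      ten-times = component-bounded uK K⊆S clo nc (κ∈ zero) (κ∈ (suc zero)) κ-distinct

      pairs-of-five : ∀ {K : List (Fin n)} → length K ≡ 5 → length (pairs K) ≡ 10
      pairs-of-five {_ ∷ _ ∷ _ ∷ _ ∷ _ ∷ []} _ = refl

      weigh : ∀ {T T'} → length (pairs K) ^ 5 * T ≤ T' → Bounded 1 T 1 (MaxIn (S ∖ K)) → Bounded 1 T' 1 (MaxIn S)
      weigh {T} {T'} le b = Bounded-rescale
        (*-monoˡ-≤ 1 (subst (length (pairs K) ^ 5 * T ≤_) (≡.sym (*-identityˡ T')) le)) (ten-times b)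

    -- The ten pairs of `K` give a factor 10, exactly what five vertices add to 10^(|S|/5); so both
    -- alternatives pass from G[S - K] to G[S].
    block-verdict : Verdict (S ∖ K) → Verdict S
    block-verdict (tight b E) =
      tight (weigh (subst (λ d → d ^ 5 * 10 ^ ∣ S ∖ K ∣ ≤ 10 ^ ∣ S ∣) (≡.sym (pairs-of-five {K} |K|≡5)) (power-step 10 5 drop5)) b) (add-block E)
    block-verdict (strict b) =
      strict (weigh (subst (λ d → d ^ 5 * (10 ^ ∣ S ∖ K ∣ ∸ 1) ≤ 10 ^ ∣ S ∣ ∸ 1) (≡.sym (pairs-of-five {K} |K|≡5)) (power-step-∸1 10 5 drop5)) b)

  maxDeg : ∀ {d S} → ¬ (∃ λ v → v ∈ S × d < length (nbrs S v)) → MaxDeg d S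
  maxDeg {d} {S} ¬big {v} R v∈S uR h = ≮⇒≥ λ d<R → ¬big (v , v∈S ,
    ≤-trans d<R (Unique-⊆-length uR λ w∈ → complete (nbrs-Nbrs S v) (proj₁ (All.lookup h w∈)) (proj₂ (All.lookup h w∈))))

  module Induction (S : Subset n) (ih : ∀ S' → ∣ S' ∣ < ∣ S ∣ → Verdict S') where

    private
      good-ih : ∀ S' → ∣ S' ∣ < ∣ S ∣ → Good S'
      good-ih S' lt = verdict⇒good (ih S' lt)

    open Step G S good-ih
    open Cases G S good-ih
    open Cycles G S good-ih

    degree≥4 : ∀ {v} → v ∈ S → ∀ L → Nbrs S v L → 4 ≤ length L → Verdict S
    degree≥4 {v} v∈S L@(_ ∷ _ ∷ _ ∷ _ ∷ _ ∷ _) N _ =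
      strict (rare⇒strict (high-degree v∈S N (s≤s (s≤s (s≤s (s≤s (s≤s z≤n)))))))
    degree≥4 {v} v∈S L@(a ∷ b ∷ c ∷ d ∷ []) N _ with all-closed-or-open v L
    ... | inj₂ (u , x ∷ y ∷ z ∷ [] , p , o) = strict (rare⇒strict (degree-four v∈S (Nbrs-↭ p N) o))
    ... | inj₂ (u , [] , p , o) with () ← ↭-length p
    ... | inj₂ (u , _ ∷ [] , p , o) with () ← ↭-length p
    ... | inj₂ (u , _ ∷ _ ∷ [] , p , o) with () ← ↭-length p
    ... | inj₂ (u , _ ∷ _ ∷ _ ∷ _ ∷ _ , p , o) with () ← ↭-length p
    ... | inj₁ cl with cherry-bound v∈S N cl | dominated-closed v∈S N cl
    ...   | inj₁ b  | _ = strict (rare⇒strict (rare-mono tt b))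
    ...   | inj₂ nc | K⊆S , clo , _ = block-verdict refl uK K⊆S clo nc (ih _ (≤-trans (s≤s (m≤n+m _ 4)) (∖-drop _ uK K⊆S)))
      where uK = v∷L-unique v∈S N
    degree≥4 v∈S [] N ()
    degree≥4 v∈S (_ ∷ []) N (s≤s ())
    degree≥4 v∈S (_ ∷ _ ∷ []) N (s≤s (s≤s ()))
    degree≥4 v∈S (_ ∷ _ ∷ _ ∷ []) N (s≤s (s≤s (s≤s ())))

    degree≤1 : ∀ {v} → MaxDeg 3 S → v ∈ S → ∀ L → Nbrs S v L → length L ≤ 1 → Verdict S
    degree≤1 Δ v∈S [] N _ = strict (rare⇒strict (rare-mono tt (isolated-vertex v∈S N)))
    degree≤1 {v} Δ v∈S (o ∷ []) N _ = strict (rare⇒strict (rare-mono tt (leaf-bound Δ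
      (v∈S , proj₁ (sound N (here refl)) , proj₂ (sound N (here refl)) , λ w∈ v~w → single (complete N w∈ v~w)))))
      where
      single : ∀ {w} → w ∈ₗ (o ∷ []) → w ≡ o
      single (here e) = e
    degree≤1 Δ v∈S (_ ∷ _ ∷ _) N (s≤s ())

    minDeg2 : ¬ (∃ λ v → v ∈ S × length (nbrs S v) ≤ 1) → MinDeg2
    minDeg2 ¬small {v} v∈S o with nbrs S v in eq | nbrs-Nbrs S v
    ... | []     | _ = ⊥-elim (¬small (v , v∈S , subst (λ l → length l ≤ 1) (≡.sym eq) z≤n))
    ... | _ ∷ [] | _ = ⊥-elim (¬small (v , v∈S , subst (λ l → length l ≤ 1) (≡.sym eq) (s≤s z≤n)))
    ... | a ∷ b ∷ _ | N with a ≟ o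
    ...   | no a≢o   = a , proj₁ (sound N (here refl)) , proj₂ (sound N (here refl)) , a≢o
    ...   | yes refl = b , proj₁ (sound N (there (here refl))) , proj₂ (sound N (there (here refl))) ,
            (All.lookup (AllPairs.head (unique N)) (here refl) ∘ ≡.sym)

    degree-3 : ∀ {v} → MaxDeg 3 S → MinDeg2 → v ∈ S → ∀ L → Nbrs S v L → 3 ≤ length L → Verdict S
    degree-3 Δ δ v∈S (a ∷ b ∷ c ∷ []) N _ = strict (rare⇒strict (degree-three Δ δ v∈S N))
    degree-3 Δ δ v∈S L@(_ ∷ _ ∷ _ ∷ _ ∷ _) N _ with Δ L v∈S (unique N) (All.tabulate (sound N))
    ... | s≤s (s≤s (s≤s ()))
    degree-3 Δ δ v∈S (_ ∷ []) N (s≤s ())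
    degree-3 Δ δ v∈S (_ ∷ _ ∷ []) N (s≤s (s≤s ()))

    degree-2 : ∀ {v} → MaxDeg 2 S → MinDeg2 → v ∈ S → ∀ L → Nbrs S v L → 1 < length L → Verdict S
    degree-2 Δ δ v∈S (a ∷ b ∷ []) N _ = strict (rare⇒strict (degree-two Δ δ v∈S N))
    degree-2 Δ δ v∈S L@(_ ∷ _ ∷ _ ∷ _) N _ with Δ L v∈S (unique N) (All.tabulate (sound N))
    ... | s≤s (s≤s ())
    degree-2 Δ δ v∈S (_ ∷ []) N (s≤s ())

    -- The order of the tests supplies the hypotheses: the leaf bound relies on degrees at most 3,
    -- the degree-three analysis also on minimum degree 2, and what survives all tests is 2-regular.
    step : Verdict S
    step with Fin.any? (_∈? S)
    ... | no ¬v = no-vertices λ v∈ → ¬v (_ , v∈)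
    ... | yes (v , v∈S) with Fin.any? (λ w → (w ∈? S) ×-dec (4 ≤? length (nbrs S w)))
    ...   | yes (w , w∈S , big) = degree≥4 w∈S (nbrs S w) (nbrs-Nbrs S w) big
    ...   | no ¬4 with Fin.any? (λ w → (w ∈? S) ×-dec (length (nbrs S w) ≤? 1))
    ...     | yes (w , w∈S , small) = degree≤1 (maxDeg ¬4) w∈S (nbrs S w) (nbrs-Nbrs S w) small
    ...     | no ¬1 with Fin.any? (λ w → (w ∈? S) ×-dec (3 ≤? length (nbrs S w)))
    ...       | yes (w , w∈S , big) = degree-3 (maxDeg ¬4) (minDeg2 ¬1) w∈S (nbrs S w) (nbrs-Nbrs S w) big
    ...       | no ¬3 = degree-2 (maxDeg ¬3) (minDeg2 ¬1) v∈S (nbrs S v) (nbrs-Nbrs S v) (≰⇒> λ le → ¬1 (v , v∈S , le))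

  verdict : ∀ m S → ∣ S ∣ < m → Verdict S
  verdict (suc m) S (s≤s le) = Induction.step S λ S' lt → verdict m S' (≤-trans lt le)

-- The count in extremal graphs

disjoint-apart : ∀ {e M x y z} → All (Disjoint e) M → Joins e x y → ¬ Any (λ e' → Joins e' x z) M
disjoint-apart ((n , _) ∷ _)         (inj₁ (refl , _)) (here (inj₁ (refl , _))) = n refl
disjoint-apart ((_ , n , _) ∷ _)     (inj₁ (refl , _)) (here (inj₂ (refl , _))) = n refl
disjoint-apart ((_ , _ , n , _) ∷ _) (inj₂ (refl , _)) (here (inj₁ (refl , _))) = n refl
disjoint-apart ((_ , _ , _ , n) ∷ _) (inj₂ (refl , _)) (here (inj₂ (refl , _))) = n refl
disjoint-apart (_ ∷ ds)              j                 (there p)                = disjoint-apart ds j p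

matched-once : ∀ {M x y z} → AllPairs Disjoint M → Any (λ e → Joins e x y) M → Any (λ e → Joins e x z) M → y ≡ z
matched-once _ (here (inj₁ (refl , refl))) (here (inj₁ (refl , refl))) = refl
matched-once _ (here (inj₁ (refl , refl))) (here (inj₂ (refl , refl))) = refl
matched-once _ (here (inj₂ (refl , refl))) (here (inj₁ (refl , refl))) = refl
matched-once _ (here (inj₂ (refl , refl))) (here (inj₂ (refl , refl))) = refl
matched-once (ds ∷ _) (here j)  (there q) = ⊥-elim (disjoint-apart ds j q)
matched-once (ds ∷ _) (there p) (here j)  = ⊥-elim (disjoint-apart ds j p)
matched-once (_ ∷ ds) (there p) (there q) = matched-once ds p q

-- Two missing edges at `x` would be two edges of the matching sharing `x`.
K5minus-no-cherry : ∀ (M : Matching5) {x y z} → x ≢ y → x ≢ z → y ≢ z →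
  K5minus (edges M) x y ≡ true ⊎ K5minus (edges M) x z ≡ true
K5minus-no-cherry M {x} {y} {z} x≢y x≢z y≢z
  rewrite dec-false (x ≟ y) x≢y | dec-false (x ≟ z) x≢z
  with edgeIn (edges M) x y in xy | edgeIn (edges M) x z in xz
... | false | _     = inj₁ refl
... | true  | false = inj₂ refl
... | true  | true  = ⊥-elim (y≢z (matched-once (Matching5.disjoint M) (edgeIn-joins (edges M) {x} {y} xy) (edgeIn-joins (edges M) {x} {z} xz)))

ten-pairs : List (Fin 5 × Fin 5)
ten-pairs = pairs (allFin 5)

InPair : Fin 10 → Fin 5 → Set
InPair c a = a ≡ proj₁ (lookup ten-pairs c) ⊎ a ≡ proj₂ (lookup ten-pairs c)

inPair? : ∀ c a → Dec (InPair c a)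
inPair? c a = (a ≟ proj₁ (lookup ten-pairs c)) ⊎-dec (a ≟ proj₂ (lookup ten-pairs c))

element : Fin 10 → Fin 2 → Fin 5
element c zero       = proj₁ (lookup ten-pairs c)
element c (suc zero) = proj₂ (lookup ten-pairs c)

ten-pairs-distinct : ∀ c → element c zero ≢ element c (suc zero)
ten-pairs-distinct = from-yes (Fin.all? λ c → ¬? (element c zero ≟ element c (suc zero)))

element∈ : ∀ c b → InPair c (element c b)
element∈ c zero       = inj₁ refl
element∈ c (suc zero) = inj₂ refl

element-injective : ∀ c {b b'} → element c b ≡ element c b' → b ≡ b'
element-injective c {zero}     {zero}     _ = refl
element-injective c {zero}     {suc zero} e = ⊥-elim (ten-pairs-distinct c e)
element-injective c {suc zero} {zero}     e = ⊥-elim (ten-pairs-distinct c (≡.sym e))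
element-injective c {suc zero} {suc zero} _ = refl

inPair-injective : ∀ c c' → (∀ a → does (inPair? c a) ≡ does (inPair? c' a)) → c ≡ c'
inPair-injective = from-yes (Fin.all? λ c → Fin.all? λ c' →
  Fin.all? (λ a → does (inPair? c a) Bool.≟ does (inPair? c' a)) →-dec (c ≟ c'))

inPair-two : ∀ {c a b d} → InPair c a → InPair c b → InPair c d → a ≢ b → a ≢ d → b ≡ d
inPair-two (inj₁ refl) (inj₁ refl) _           n _ = ⊥-elim (n refl)
inPair-two (inj₁ refl) (inj₂ refl) (inj₁ refl) _ n = ⊥-elim (n refl)
inPair-two (inj₁ refl) (inj₂ refl) (inj₂ refl) _ _ = refl
inPair-two (inj₂ refl) (inj₂ refl) _           n _ = ⊥-elim (n refl)
inPair-two (inj₂ refl) (inj₁ refl) (inj₂ refl) _ n = ⊥-elim (n refl)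
inPair-two (inj₂ refl) (inj₁ refl) (inj₁ refl) _ _ = refl

length-cartesianProductWith : ∀ {A B C : Set} (f : A → B → C) xs ys →
  length (cartesianProductWith f xs ys) ≡ length xs * length ys
length-cartesianProductWith f []       ys = refl
length-cartesianProductWith f (x ∷ xs) ys = ≡.trans (length-++ (map (f x) ys))
  (cong₂ _+_ (length-map (f x) ys) (length-cartesianProductWith f xs ys))

choices : ∀ k → List (Vec (Fin 10) k)
choices zero    = [] ∷ []
choices (suc k) = cartesianProductWith _∷_ (allFin 10) (choices k)

choices-unique : ∀ k → Unique (choices k)
choices-unique zero    = [] ∷ []
choices-unique (suc k) = Unique.cartesianProductWith⁺ _∷_ ∷-injective (Unique.allFin⁺ 10) (choices-unique k)

length-choices : ∀ k → length (choices k) ≡ 10 ^ k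
length-choices zero    = refl
length-choices (suc k) = ≡.trans (length-cartesianProductWith _∷_ (allFin 10) (choices k)) (cong (10 *_) (length-choices k))

length-concatMap-≤ : ∀ {A B : Set} (f : A → List B) m → (∀ x → length (f x) ≤ m) → ∀ xs → length (concatMap f xs) ≤ length xs * m
length-concatMap-≤ f m h []       = z≤n
length-concatMap-≤ f m h (x ∷ xs) =
  ≤-trans (≤-reflexive (length-++ (f x))) (+-mono-≤ (h x) (length-concatMap-≤ f m h xs))

allSubsets-unique : ∀ n → Unique (allSubsets n)
allSubsets-unique zero    = [] ∷ []
allSubsets-unique (suc n) = Unique.++⁺ (Unique.map⁺ (λ { refl → refl }) (allSubsets-unique n))
  (Unique.map⁺ (λ { refl → refl }) (allSubsets-unique n)) different
  where
  different : ∀ {F} → ¬ (F ∈ₗ map (inside ∷_) (allSubsets n) × F ∈ₗ map (outside ∷_) (allSubsets n))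
  different (p , q) with _ , _ , refl ← ∈-map⁻ (inside ∷_) p with _ , _ , () ← ∈-map⁻ (outside ∷_) q

∈-allSubsets : ∀ {n} (F : Subset n) → F ∈ₗ allSubsets n
∈-allSubsets []            = here refl
∈-allSubsets (inside  ∷ F) = ∈-++⁺ˡ (∈-map⁺ _ (∈-allSubsets F))
∈-allSubsets {suc n} (outside ∷ F) = ∈-++⁺ʳ (map (inside ∷_) (allSubsets n)) (∈-map⁺ _ (∈-allSubsets F))

module LowerBound {n k : ℕ} (G : Graph n) (M : Fin k → Matching5) (σ : Fin n ↔ (Fin k × Fin 5))
  (adjacent : ∀ u v → adj G u v ≡ unionAdj M (Inverse.to σ u) (Inverse.to σ v)) where
  open Dissociation G

  private
    block : Fin n → Fin k
    block = proj₁ ∘ Inverse.to σ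

    position : Fin n → Fin 5
    position = proj₂ ∘ Inverse.to σ

    τ : Fin k × Fin 5 → Fin n
    τ = Inverse.from σ

    to-τ : ∀ p → Inverse.to σ (τ p) ≡ p
    to-τ = Inverse.strictlyInverseˡ σ

    τ-to : ∀ v → τ (Inverse.to σ v) ≡ v
    τ-to = Inverse.strictlyInverseʳ σ

    τ-injective : ∀ {p q} → τ p ≡ τ q → p ≡ q
    τ-injective {p} {q} e = ≡.trans (≡.sym (to-τ p)) (≡.trans (cong (Inverse.to σ) e) (to-τ q))

    to-injective : ∀ {u v} → block u ≡ block v → position u ≡ position v → u ≡ v
    to-injective {u} {v} e e' = ≡.trans (≡.sym (τ-to u)) (≡.trans (cong τ (cong₂ _,_ e e')) (τ-to v))

    unionAdj-true : ∀ p q → unionAdj M p q ≡ true → proj₁ p ≡ proj₁ q × proj₂ p ≢ proj₂ q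
    unionAdj-true (i , a) (j , b) h with i ≟ j | a ≟ b
    unionAdj-true (i , a) (j , b) h  | yes i≡j | no a≢b = i≡j , a≢b
    unionAdj-true (i , a) (j , b) () | yes _   | yes _
    unionAdj-true (i , a) (j , b) () | no _    | _

    adjacent-true : ∀ {u v} → u ~ v → block u ≡ block v × position u ≢ position v
    adjacent-true {u} {v} u~v = unionAdj-true (Inverse.to σ u) (Inverse.to σ v) (≡.trans (≡.sym (adjacent u v)) u~v)

    adjacent-in : ∀ {j a b} → K5minus (edges (M j)) a b ≡ true → τ (j , a) ~ τ (j , b)
    adjacent-in {j} {a} {b} h = ≡.trans (adjacent (τ (j , a)) (τ (j , b)))
      (≡.trans (cong₂ (unionAdj M) (to-τ (j , a)) (to-τ (j , b)))
        (subst (λ z → z ∧ K5minus (edges (M j)) a b ≡ true) (≡.sym (dec-true (j ≟ j) refl)) h))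

    chosen? : ∀ (c : Vec (Fin 10) k) v → Dec (InPair (Vec.lookup c (block v)) (position v))
    chosen? c v = inPair? (Vec.lookup c (block v)) (position v)

    chosen : Vec (Fin 10) k → Subset n
    chosen c = select (chosen? c)

    chosen-injective : ∀ {c c'} → chosen c ≡ chosen c' → c ≡ c'
    chosen-injective {c} {c'} e = ≡.trans (≡.sym (tabulate∘lookup c)) (≡.trans (tabulate-cong same) (tabulate∘lookup c'))
      where
      agree : ∀ v → does (chosen? c v) ≡ does (chosen? c' v)
      agree v = ≡.trans (≡.sym (lookup∘tabulate (does ∘ chosen? c) v))
        (≡.trans (cong (λ F → Vec.lookup F v) e) (lookup∘tabulate (does ∘ chosen? c') v))
      same : ∀ j → Vec.lookup c j ≡ Vec.lookup c' j
      same j = inPair-injective _ _ λ a →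
        subst (λ (j , a) → does (inPair? (Vec.lookup c j) a) ≡ does (inPair? (Vec.lookup c' j) a)) (to-τ (j , a)) (agree (τ (j , a)))

    -- Adjacent vertices share a block, and each block contributes just one pair, so a chosen vertex
    -- has at most one possible neighbour.
    chosen-diss : ∀ c → Diss (chosen c)
    chosen-diss c u v w u∈ v∈ w∈ u~v u~w with adjacent-true u~v | adjacent-true u~w
    ... | uv , u≢v | uw , u≢w = to-injective (≡.trans (≡.sym uv) uw)
      (inPair-two {Vec.lookup c (block u)} (∈-select⁻ (chosen? c) u∈)
        (subst (λ j → InPair (Vec.lookup c j) (position v)) (≡.sym uv) (∈-select⁻ (chosen? c) v∈))
        (subst (λ j → InPair (Vec.lookup c j) (position w)) (≡.sym uw) (∈-select⁻ (chosen? c) w∈)) u≢v u≢w)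

    ∣∅∣ : ∣ ∅ {n} ∣ ≡ 0
    ∣∅∣ = ∣⊥∣≡0 n

    chosen-size : ∀ c → k * 2 ≤ ∣ chosen c ∣
    chosen-size c = subst (_≤ ∣ chosen c ∣) (≡.trans (cong₂ _+_ size ∣∅∣) (+-identityʳ _))
      (∣∣-drop R (λ v∈ → ⊥-elim (∉⊥ v∈)) (Unique.map⁺ τ'-injective (Unique.cartesianProduct⁺ (Unique.allFin⁺ k) (Unique.allFin⁺ 2)))
        (All.tabulate R⊆) (All.tabulate λ _ → ∉⊥))
      where
      τ' : Fin k × Fin 2 → Fin n
      τ' (j , b) = τ (j , element (Vec.lookup c j) b)
      τ'-injective : ∀ {p q} → τ' p ≡ τ' q → p ≡ q
      τ'-injective {j , b} {j' , b'} e with τ-injective e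
      ... | e' with cong proj₁ e'
      ...   | refl = cong (j ,_) (element-injective (Vec.lookup c j) (cong proj₂ e'))
      R = map τ' (cartesianProduct (allFin k) (allFin 2))
      R⊆ : ∀ {v} → v ∈ₗ R → v ∈ chosen c
      R⊆ v∈ with (j , b) , _ , refl ← ∈-map⁻ τ' v∈ = ∈-select⁺ (chosen? c)
        (subst (λ (j , a) → InPair (Vec.lookup c j) a) (≡.sym (to-τ _)) (element∈ (Vec.lookup c j) b))
      size : length R ≡ k * 2
      size = ≡.trans (length-map τ' (cartesianProduct (allFin k) (allFin 2))) (≡.trans (length-cartesianProductWith _,_ (allFin k) (allFin 2))
        (cong (_* 2) (length-tabulate {n = k} id)))

    -- The complement of a block is a matching, so by `no-three` a dissociation set has at most two
    -- vertices in each block.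
    diss-size : ∀ F → Diss F → ∣ F ∣ ≤ k * 2
    diss-size F d = ≤-trans (∣∣-cover {B = ∅} L (inj₂ ∘ cover)) (subst (λ z → length L + z ≤ k * 2) (≡.sym ∣∅∣)
        (subst (_≤ k * 2) (≡.sym (+-identityʳ (length L)))
          (subst (λ z → length L ≤ z * 2) (length-tabulate {n = k} id) (length-concatMap-≤ part 2 part≤2 (allFin k)))))
      where
      in? : ∀ j a → Dec (τ (j , a) ∈ F)
      in? j a = τ (j , a) ∈? F
      part : Fin k → List (Fin n)
      part j = map (λ a → τ (j , a)) (filter (in? j) (allFin 5))
      L = concatMap part (allFin k)
      cover : ∀ {v} → v ∈ F → v ∈ₗ L
      cover {v} v∈F = ∈-concatMap⁺ part {xs = allFin k} (lose (∈-allFin (block v))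
        (subst (_∈ₗ part (block v)) (τ-to v)
          (∈-map⁺ (λ a → τ (block v , a)) (∈-filter⁺ (in? (block v)) (∈-allFin (position v)) (subst (_∈ F) (≡.sym (τ-to v)) v∈F)))))
      part≤2 : ∀ j → length (part j) ≤ 2
      part≤2 j = subst (_≤ 2) (≡.sym (length-map _ (filter (in? j) (allFin 5))))
        (at-most (filter (in? j) (allFin 5)) (Unique.filter⁺ (in? j) (Unique.allFin⁺ 5)) (λ a∈ → proj₂ (∈-filter⁻ (in? j) {xs = allFin 5} a∈)))
        where
        K = map (λ a → τ (j , a)) (allFin 5)
        in-K : ∀ a → τ (j , a) ∈ₗ K
        in-K a = ∈-map⁺ (λ a → τ (j , a)) (∈-allFin a)
        nc : NoCherry K
        nc x∈ y∈ z∈ x≢y x≢z y≢z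
          with a , _ , refl ← ∈-map⁻ (λ a → τ (j , a)) x∈
          with b , _ , refl ← ∈-map⁻ (λ a → τ (j , a)) y∈
          with c , _ , refl ← ∈-map⁻ (λ a → τ (j , a)) z∈
          = Sum.map adjacent-in adjacent-in (K5minus-no-cherry (M j) {a} {b} {c} (λ { refl → x≢y refl }) (λ { refl → x≢z refl }) (λ { refl → y≢z refl }))
        at-most : ∀ l → Unique l → (∀ {a} → a ∈ₗ l → τ (j , a) ∈ F) → length l ≤ 2
        at-most [] _ _ = z≤n
        at-most (_ ∷ []) _ _ = s≤s z≤n
        at-most (_ ∷ _ ∷ []) _ _ = s≤s (s≤s z≤n)
        at-most (a ∷ b ∷ c ∷ _) ((a≢b ∷ a≢c ∷ _) ∷ (b≢c ∷ _) ∷ _) h =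
          ⊥-elim (no-three nc d (in-K a) (in-K b) (in-K c) (h (here refl)) (h (there (here refl))) (h (there (there (here refl))))
            (distinct a≢b) (distinct a≢c) (distinct b≢c))
          where
          distinct : ∀ {a b} → a ≢ b → τ (j , a) ≢ τ (j , b)
          distinct a≢b e = a≢b (cong proj₂ (τ-injective e))

  -- Every choice of one pair per block reaches the largest possible size 2 k, and distinct choices
  -- give distinct sets.
  lower-bound : 10 ^ k ≤ φ′ G
  lower-bound = subst (_≤ φ′ G) (≡.trans (length-map chosen (choices k)) (length-choices k))
    (Unique-⊆-length (Unique.map⁺ chosen-injective (choices-unique k)) maximum)
    where
    maximum : ∀ {F} → F ∈ₗ map chosen (choices k) → F ∈ₗ filter (isMaxDissociation? G) (allSubsets n)
    maximum F∈ with c , _ , refl ← ∈-map⁻ chosen F∈ = ∈-filter⁺ (isMaxDissociation? G) (∈-allSubsets (chosen c))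
      (chosen-diss c , λ F' d → ≤-trans (diss-size F' d) (chosen-size c))

-- The bound and the equality case for the whole graph

module _ {n : ℕ} (G : Graph n) where
  open Dissociation G
  open Classification G

  private
    maximum-list : List (Subset n)
    maximum-list = filter (isMaxDissociation? G) (allSubsets n)

    maximum-unique : Unique maximum-list
    maximum-unique = Unique.filter⁺ (isMaxDissociation? G) (allSubsets-unique n)

    maximum-MaxIn : All (MaxIn ⊤) maximum-list
    maximum-MaxIn = All.map (λ (d , best) → maxIn (λ _ → ∈⊤) d (λ {F'} _ d' → best F' d')) (All.all-filter (isMaxDissociation? G) (allSubsets n))

    bound-at : ∀ {T} → Bounded 1 T 1 (MaxIn ⊤) → φ′ G ^ 5 ≤ T
    bound-at {T} b = subst₂ _≤_ (*-identityʳ _) (*-identityˡ T) (length-bound b maximum-list maximum-unique maximum-MaxIn)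

    verdict-⊤ : Verdict ⊤
    verdict-⊤ = verdict (suc ∣ ⊤ {n} ∣) ⊤ ≤-refl

  upper-bound : φ′ G ^ 5 ≤ 10 ^ n
  upper-bound = subst (λ m → φ′ G ^ 5 ≤ 10 ^ m) (∣⊤∣≡n n) (bound-at (verdict⇒good verdict-⊤))

  Extremal⇒IsExtremal : Extremal ⊤ → IsExtremal G
  Extremal⇒IsExtremal E = k , ≡.trans (≡.sym (∣⊤∣≡n n)) size , matching , few-edges , σ , λ u v →
    ≡.trans (cong₂ (adj G) (≡.sym (proj₂ (surjective ∈⊤))) (≡.sym (proj₂ (surjective ∈⊤)))) (adjacent _ _)
    where
    open Extremal E
    σ : Fin n ↔ (Fin k × Fin 5)
    σ = mk↔ₛ′ (λ v → proj₁ (surjective {v} ∈⊤)) vertex (λ p → injective (proj₂ (surjective ∈⊤))) (λ v → proj₂ (surjective ∈⊤))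

  equality⇒extremal : φ′ G ^ 5 ≡ 10 ^ n → IsExtremal G
  equality⇒extremal e with verdict-⊤
  ... | tight _ E = Extremal⇒IsExtremal E
  -- Equality together with strictness would give 10^n ≤ 10^n - 1.
  ... | strict b  = ⊥-elim (<⇒≱ (∸-monoʳ-< {o = 0} (s≤s z≤n) (m^n>0 10 n)) (subst₂ _≤_ e (cong (λ m → 10 ^ m ∸ 1) (∣⊤∣≡n n)) (bound-at b)))

  extremal⇒equality : IsExtremal G → φ′ G ^ 5 ≡ 10 ^ n
  extremal⇒equality (k , n≡5k , M , _ , σ , h) = ≤-antisym upper-bound
    (subst (_≤ φ′ G ^ 5) (≡.trans (^-*-assoc 10 k 5) (cong (10 ^_) (≡.trans (*-comm k 5) (≡.sym n≡5k))))
      (^-monoˡ-≤ 5 (LowerBound.lower-bound G M σ h)))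

theorem1p3 : (n : ℕ) (G : Graph n) →
    (φ′ G ^ 5 ≤ 10 ^ n) × ((φ′ G ^ 5 ≡ 10 ^ n) ⇔ IsExtremal G)
theorem1p3 n G = upper-bound G , mk⇔ (equality⇒extremal G) (extremal⇒equality G)
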